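{- Let $q$ be an odd prime power, $d\ge 2$, $\gamma\in\mathbb{F}_q^*$ a non-square, and let $W\subset \{v\in\mathbb{F}_q^d:\|v\|\in\{1,\gamma\}\}$ contain exactly one element of each pair $\{v,-v\}$. Let $E\subset\mathbb{F}_q^d$ and let $F\subset W\times\mathbb{F}_q$, identified with the set of non-degenerate hyperplanes $\{H_{v,t}:(v,t)\in F\}$ (each non-degenerate hyperplane has exactly one such representation), and write $F(v,t)$ for the indicator function of $F$. Then $$|\Delta(E,F)| \ge \frac{|E|^2|F|^2}{2q^{ -1}|E|^2|F|^2 + 2q^{d-1}|E||F|\cdot \max_{v\in W}\sum_{t\in\mathbb{F}_q}F(v,t)}.$$ In particular, if $|E||F|>q^{d+1}$, then $|\Delta(E,F)| > q/4$, so $|\Delta(E,F)|\gg q$.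
   Context: $\mathbb{F}_q$ is the field with $q$ elements; $x\cdot y=\sum_i x_iy_i$, $\|x\|=x_1^2+\dots+x_d^2$. $H_{v,t}=\{y\in\mathbb{F}_q^d: y\cdot v=t\}$; such a hyperplane is non-degenerate if $\|v\|\ne 0$. $O_d(\mathbb{F}_q)$ is the group of linear maps $\theta$ of $\mathbb{F}_q^d$ with $\|\theta y\|=\|y\|$ for all $y$. Pairs $(x,h)$ and $(x',h')$ (point, hyperplane) are equivalent if there is $\theta\in O_d(\mathbb{F}_q)$ with $\{\theta(y-x)+x': y\in h\}=h'$. $\Delta(E,F)$ is the set of equivalence classes of pairs $(x,H_{v,t})$ with $x\in E$, $(v,t)\in F$. -}

module Defs where

open import Level using (0ℓ)
open import Algebra.Structures using (IsCommutativeRing)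
open import Data.Bool using (if_then_else_)
open import Data.Fin using (Fin)
open import Data.Fin.Properties using (nonZeroIndex; inj⇒≟)
open import Data.Integer using (+_)
open import Data.List using (List; []; _∷_; allFin; cartesianProduct;
  cartesianProductWith; deduplicate; filter; length; map; sum)
open import Data.List.Extrema.Nat using (max)
open import Data.List.Membership.Propositional using (_∈_; lose)
open import Data.List.Membership.Propositional.Properties
  using (∈-allFin; ∈-cartesianProduct⁺; ∈-cartesianProductWith⁺; ∈-map⁺)
import Data.List.Relation.Unary.All as All
import Data.List.Relation.Unary.Any as Any
open import Data.List.Relation.Unary.Any using (here)
open import Data.Nat using (ℕ; NonZero; _^_; _<_)
open import Data.Nat.Divisibility using (_∣_)
open import Data.Nat.Primality using (Prime)
open import Data.Product using (∃; ∃₂; _×_; _,_; proj₁; proj₂)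
open import Data.Rational as ℚ using (ℚ)
open import Data.Sum using (_⊎_)
open import Data.Vec as Vec using (Vec; []; _∷_; replicate; zipWith)
open import Data.Vec.Properties using (≡-dec)
open import Function.Bundles using (_↔_; Inverse)
open import Function.Properties.Inverse using (↔⇒↣)
open import Relation.Binary.Definitions using (DecidableEquality)
open import Relation.Binary.PropositionalEquality
open import Relation.Nullary using (Dec; does; ¬_)
open import Relation.Nullary.Decidable using (map′; _×-dec_; _→-dec_)
open import Relation.Unary using (Pred; Decidable; _≐_)

IsOddPrimePower : ℕ → Set
IsOddPrimePower q =
  ¬ (2 ∣ q) × ∃₂ λ p k → Prime p × 0 < k × q ≡ p ^ k

record FiniteField (q : ℕ) : Set₁ where
  infix  8 -_
  infixl 7 _*_
  infixl 6 _+_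
  field
    Carrier           : Set
    _+_ _*_           : Carrier → Carrier → Carrier
    -_                : Carrier → Carrier
    0# 1#             : Carrier
    isCommutativeRing : IsCommutativeRing _≡_ _+_ _*_ -_ 0# 1#
    0≢1               : 0# ≢ 1#
    inverse           : ∀ x → x ≢ 0# → ∃ λ y → x * y ≡ 1#
    enumeration       : Carrier ↔ Fin q

  infix 4 _≟_
  _≟_ : DecidableEquality Carrier
  _≟_ = inj⇒≟ (↔⇒↣ enumeration)

  elements : List Carrier
  elements = map (Inverse.from enumeration) (allFin q)

  ∈-elements : ∀ x → x ∈ elements
  ∈-elements x = subst (_∈ elements)
    (Inverse.strictlyInverseʳ enumeration x)
    (∈-map⁺ (Inverse.from enumeration) (∈-allFin (Inverse.to enumeration x)))

  q-nonZero : NonZero q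
  q-nonZero = nonZeroIndex (Inverse.to enumeration 0#)

  IsSquare : Carrier → Set
  IsSquare a = ∃ λ z → z * z ≡ a

module _ {A : Set} where

  vectors : List A → ∀ n → List (Vec A n)
  vectors xs 0           = [] ∷ []
  vectors xs (ℕ.suc n) = cartesianProductWith _∷_ xs (vectors xs n)

  ∈-vectors : ∀ {xs} → (∀ x → x ∈ xs) → ∀ {n} (v : Vec A n) → v ∈ vectors xs n
  ∈-vectors ∈xs []      = here refl
  ∈-vectors ∈xs (x ∷ v) =
    ∈-cartesianProductWith⁺ _∷_ (∈xs x) (∈-vectors ∈xs v)

  module _ {xs : List A} (∈xs : ∀ x → x ∈ xs) {P : Pred A 0ℓ} where

    ∀-dec : Decidable P → Dec (∀ x → P x)
    ∀-dec P? = map′ (λ ps x → All.lookup ps (∈xs x))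
                    (λ p → All.tabulate (λ {x} _ → p x)) (All.all? P? xs)

    ∃-dec : Decidable P → Dec (∃ P)
    ∃-dec P? = map′ Any.satisfied (λ (x , p) → lose (∈xs x) p)
                    (Any.any? P? xs)

fromℕ : ℕ → ℚ
fromℕ n = + n ℚ./ 1

-- A subset of a finite set is a decidable predicate; its cardinality is
-- computed from a list containing each element of the ambient set once.
module Geometry {q : ℕ} (𝔽 : FiniteField q) (d : ℕ) where
  open FiniteField 𝔽
  open IsCommutativeRing isCommutativeRing
    using (+-identityˡ; +-identityʳ; *-identityʳ; zeroˡ; zeroʳ)

  infixl 7 _·_ _*ᵥ_
  infixl 6 _+ᵥ_ _-ᵥ_
  infix  8 -ᵥ_

  _+ᵥ_ : ∀ {n} → Vec Carrier n → Vec Carrier n → Vec Carrier n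
  _+ᵥ_ = zipWith _+_

  -ᵥ_ : ∀ {n} → Vec Carrier n → Vec Carrier n
  -ᵥ_ = Vec.map -_

  _-ᵥ_ : ∀ {n} → Vec Carrier n → Vec Carrier n → Vec Carrier n
  x -ᵥ y = x +ᵥ (-ᵥ y)

  _*ᵥ_ : ∀ {n} → Carrier → Vec Carrier n → Vec Carrier n
  a *ᵥ x = Vec.map (a *_) x

  _·_ : ∀ {n} → Vec Carrier n → Vec Carrier n → Carrier
  x · y = Vec.foldr′ _+_ 0# (zipWith _*_ x y)

  -- The quadratic form x₁² + … + x_d², with no square root.
  ‖_‖ : ∀ {n} → Vec Carrier n → Carrier
  ‖ x ‖ = x · x

  Point : Set
  Point = Vec Carrier d

  infix 4 _≟ₚ_
  _≟ₚ_ : DecidableEquality Point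
  _≟ₚ_ = ≡-dec _≟_

  H : Point → Carrier → Pred Point 0ℓ
  H v t y = y · v ≡ t

  record IsLinear {n} (θ : Vec Carrier n → Point) : Set where
    constructor mkLinear
    field
      +-homo : ∀ x y → θ (x +ᵥ y) ≡ θ x +ᵥ θ y
      *-homo : ∀ a x → θ (a *ᵥ x) ≡ a *ᵥ θ x

  -- θ ∈ O_d(𝔽_q)
  record IsOrthogonal (θ : Point → Point) : Set where
    constructor mkOrthogonal
    field
      isLinear : IsLinear θ
      norm     : ∀ y → ‖ θ y ‖ ≡ ‖ y ‖

  image : (Point → Point) → Pred Point 0ℓ → Pred Point 0ℓ
  image f h z = ∃ λ y → h y × f y ≡ z

  infix 4 _≈_
  _≈_ : Point × Pred Point 0ℓ → Point × Pred Point 0ℓ → Set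
  (x , h) ≈ (x′ , h′) = ∃ λ θ →
    IsOrthogonal θ × image (λ y → θ (y -ᵥ x) +ᵥ x′) h ≐ h′

  Params : Set
  Params = Point × Carrier

  infix 4 _∼_
  _∼_ : Point × Params → Point × Params → Set
  (x , v , t) ∼ (x′ , v′ , t′) = (x , H v t) ≈ (x′ , H v′ t′)

  -- Decidability of _∼_: it is extensional in θ, and every linear θ is given
  -- by one of the finitely many d-tuples of columns.

  points₀ : ∀ n → List (Vec Carrier n)
  points₀ = vectors elements

  ∈-points₀ : ∀ {n} (x : Vec Carrier n) → x ∈ points₀ n
  ∈-points₀ = ∈-vectors ∈-elements

  0ᵥ : ∀ {n} → Vec Carrier n
  0ᵥ = replicate _ 0#

  combine : ∀ {n} → Vec Point n → Vec Carrier n → Point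
  combine []       []      = 0ᵥ
  combine (c ∷ cs) (a ∷ y) = (a *ᵥ c) +ᵥ combine cs y

  columns : ∀ {n} → (Vec Carrier n → Point) → Vec Point n
  columns {0}       θ = []
  columns {ℕ.suc n} θ = θ (1# ∷ 0ᵥ) ∷ columns (λ y → θ (0# ∷ y))

  0*ᵥ : ∀ {n} (x : Vec Carrier n) → 0# *ᵥ x ≡ 0ᵥ
  0*ᵥ []      = refl
  0*ᵥ (x ∷ v) = cong₂ _∷_ (zeroˡ x) (0*ᵥ v)

  a*ᵥ0+ : ∀ {n} a (y : Vec Carrier n) → (a *ᵥ 0ᵥ) +ᵥ y ≡ y
  a*ᵥ0+ a []      = refl
  a*ᵥ0+ a (x ∷ y) =
    cong₂ _∷_ (trans (cong (_+ x) (zeroʳ a)) (+-identityˡ x)) (a*ᵥ0+ a y)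

  combine-columns : ∀ {n} (θ : Vec Carrier n → Point) → IsLinear θ →
                    ∀ y → combine (columns θ) y ≡ θ y
  combine-columns θ lin [] =
    sym (trans (IsLinear.*-homo lin 0# []) (0*ᵥ (θ [])))
  combine-columns θ (mkLinear +-homo *-homo) (a ∷ y) = begin
    (a *ᵥ θ (1# ∷ 0ᵥ)) +ᵥ combine (columns θ₀) y
      ≡⟨ cong₂ _+ᵥ_ (sym (*-homo a _)) (combine-columns θ₀ lin₀ y) ⟩
    θ (a *ᵥ (1# ∷ 0ᵥ)) +ᵥ θ (0# ∷ y)
      ≡⟨ +-homo _ _ ⟨
    θ ((a * 1# + 0#) ∷ ((a *ᵥ 0ᵥ) +ᵥ y))
      ≡⟨ cong θ (cong₂ _∷_ (trans (+-identityʳ _) (*-identityʳ a))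
                           (a*ᵥ0+ a y)) ⟩
    θ (a ∷ y) ∎
    where
    open ≡-Reasoning
    θ₀ = λ y → θ (0# ∷ y)
    lin₀ : IsLinear θ₀
    lin₀ = mkLinear
      (λ x y → trans (cong (λ z → θ (z ∷ (x +ᵥ y))) (sym (+-identityˡ 0#)))
                     (+-homo _ _))
      (λ b x → trans (cong (λ z → θ (z ∷ (b *ᵥ x))) (sym (zeroʳ b)))
                     (*-homo b _))

  ∀ₚ : {P : Pred Point 0ℓ} → Decidable P → Dec (∀ x → P x)
  ∀ₚ = ∀-dec ∈-points₀

  isOrthogonal? : Decidable IsOrthogonal
  isOrthogonal? θ = map′
    (λ ((+h , *h) , n) → mkOrthogonal (mkLinear +h *h) n)
    (λ (mkOrthogonal (mkLinear +h *h) n) → (+h , *h) , n)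
    ((∀ₚ (λ x → ∀ₚ λ y → θ (x +ᵥ y) ≟ₚ θ x +ᵥ θ y)
      ×-dec ∀-dec ∈-elements (λ a → ∀ₚ λ x → θ (a *ᵥ x) ≟ₚ a *ᵥ θ x))
     ×-dec ∀ₚ (λ y → ‖ θ y ‖ ≟ ‖ y ‖))

  ≐-dec : {P Q : Pred Point 0ℓ} → Decidable P → Decidable Q → Dec (P ≐ Q)
  ≐-dec P? Q? = map′
    (λ (f , g) → (λ {x} → f x) , (λ {x} → g x))
    (λ (f , g) → (λ x → f {x}) , (λ x → g {x}))
    (∀ₚ (λ x → P? x →-dec Q? x) ×-dec ∀ₚ (λ x → Q? x →-dec P? x))

  isOrthogonal-ext : ∀ {θ φ} → (∀ y → φ y ≡ θ y) →
                     IsOrthogonal θ → IsOrthogonal φ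
  isOrthogonal-ext e (mkOrthogonal (mkLinear +h *h) n) = mkOrthogonal
    (mkLinear
      (λ x y → trans (e _) (trans (+h x y) (sym (cong₂ _+ᵥ_ (e x) (e y)))))
      (λ a x → trans (e _) (trans (*h a x) (sym (cong (a *ᵥ_) (e x))))))
    (λ y → trans (cong ‖_‖ (e y)) (n y))

  infix 4 _∼?_
  _∼?_ : ∀ p p′ → Dec (p ∼ p′)
  (x , v , t) ∼? (x′ , v′ , t′) = map′
    (λ (M , r) → combine M , r)
    (λ (θ , orth , ⊆ , ⊇) →
      let e = combine-columns θ (IsOrthogonal.isLinear orth) in
      columns θ , isOrthogonal-ext e orth
      , (λ (y , hy , eq) →
           ⊆ (y , hy , trans (cong (_+ᵥ x′) (sym (e (y -ᵥ x)))) eq))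
      , (λ hz → let (y , hy , eq) = ⊇ hz in
           y , hy , trans (cong (_+ᵥ x′) (e (y -ᵥ x))) eq))
    (∃-dec (∈-vectors ∈-points₀) λ M →
      isOrthogonal? (combine M)
      ×-dec ≐-dec
        (λ z → ∃-dec ∈-points₀ λ y →
          (y · v ≟ t) ×-dec (combine M (y -ᵥ x) +ᵥ x′ ≟ₚ z))
        (λ z → z · v′ ≟ t′))

  points : List Point
  points = points₀ d

  params : List Params
  params = cartesianProduct points elements

  card : {E : Pred Point 0ℓ} → Decidable E → ℕ
  card E? = length (filter E? points)

  cardₕ : {F : Pred Params 0ℓ} → Decidable F → ℕ
  cardₕ F? = length (filter F? params)

  -- |Δ(E,F)|: since _∼_ is an equivalence relation for q odd, deduplication
  -- keeps one pair from each class.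
  cardΔ : {E : Pred Point 0ℓ} {F : Pred Params 0ℓ} →
          Decidable E → Decidable F → ℕ
  cardΔ E? F? = length
    (deduplicate _∼?_ (cartesianProduct (filter E? points) (filter F? params)))

  indicator : {F : Pred Params 0ℓ} → Decidable F → Point → Carrier → ℕ
  indicator F? v t = if does (F? (v , t)) then 1 else 0

  -- The base value 0 of max is harmless: all the sums are nonnegative.
  maxFibre : {W : Pred Point 0ℓ} {F : Pred Params 0ℓ} →
             Decidable W → Decidable F → ℕ
  maxFibre W? F? =
    max 0 (map (λ v → sum (map (indicator F? v) elements)) (filter W? points))

  NormOneOr : Carrier → Pred Point 0ℓ
  NormOneOr γ v = ‖ v ‖ ≡ 1# ⊎ ‖ v ‖ ≡ γ

  -- W ⊂ {v : ‖v‖ ∈ {1,γ}} contains exactly one element of each pair {v,-v}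
  -- (v and -v are distinct, since ‖v‖ ≠ 0 and q is odd).
  record IsHalfSystem (γ : Carrier) (W : Pred Point 0ℓ) : Set where
    field
      normed      : ∀ v → W v → NormOneOr γ v
      one-of-pair : ∀ v → NormOneOr γ v →
                    (W v × ¬ W (-ᵥ v)) ⊎ (¬ W v × W (-ᵥ v))

{-# OPTIONS --safe #-}

-- For a pair (x, v, t) put s = t - x · v. Equivalent pairs have offsets s that
-- agree up to sign, so 2|Δ| bounds the number of values of s, and by
-- Cauchy-Schwarz 2|Δ| Σ_s n(s)² ≥ |E|²|F|², where n(s) counts the pairs of
-- offset s. In n(s) - |E||F|/q = Σ_{(v,t)∈F} g_v(t - s), with g_v the deviation
-- from its mean of u ↦ #{x ∈ E : x · v = u}, Cauchy-Schwarz over F reduces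
-- Σ_s n(s)² to Σ_{v∈W} Σ_u g_v(u)². The functions x ↦ g_v(x · v), v ∈ W, are
-- pairwise orthogonal because no two elements of W are parallel, and Bessel's
-- inequality for the indicator function of E bounds that sum by q^(d-1)|E|.

module Submission where

open import Defs
open import Level using (0ℓ)
open import Algebra.Bundles using (CommutativeRing)
import Algebra.Properties.Ring
import Algebra.Solver.Ring.NaturalCoefficients.Default as SemiringSolver
open import Data.Bool using (if_then_else_; true; false)
open import Data.List using (List; []; _∷_; _++_; allFin; cartesianProduct; cartesianProductWith; deduplicate; filter; length; map)
import Data.List.Extrema
open import Data.List.Membership.Propositional using (_∈_)
open import Data.List.Membership.Propositional.Properties using (∈-cartesianProduct⁺; ∈-cartesianProduct⁻; ∈-deduplicate⁻; ∈-filter⁺; ∈-filter⁻; ∈-map⁺)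
open import Data.List.Properties using (length-++; length-map; length-tabulate)
open import Data.List.Relation.Unary.All as All using (All; []; _∷_)
import Data.List.Relation.Unary.All.Properties as All
open import Data.List.Relation.Unary.Any as Any using (here; there)
open import Data.List.Relation.Unary.Unique.Propositional using (Unique; []; _∷_)
import Data.List.Relation.Unary.Unique.Propositional.Properties as Unique
open import Data.Nat as ℕ using (ℕ; zero; suc; z≤n)
open import Data.Nat.ListAction using (sum)
import Data.Nat.Properties as ℕ
open import Data.Product using (_×_; _,_; ∃; proj₁; proj₂)
open import Data.Rational as ℚ using (ℚ)
open import Data.Sum using (_⊎_; inj₁; inj₂)
open import Data.Vec as Vec using (Vec; []; _∷_)
open import Function using (_∘_; Inverse)
open import Relation.Binary.Definitions using (DecidableEquality)
open import Relation.Binary.PropositionalEquality using (_≡_; _≢_; refl; sym; trans; cong; cong₂; subst; subst₂; module ≡-Reasoning)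
open import Relation.Nullary using (¬_; Dec; does; yes; no; contradiction; ¬?)
open import Relation.Unary using (Pred; Decidable)

-- The invariant behind the sign is s² / ‖v‖, the squared distance from x to the hyperplane. When it
-- is nonzero it determines ‖v‖ up to squares, and 1 and γ lie in different square classes, so the
-- norms agree and s² itself is determined. Orthogonality of the g_v comes from translations rather
-- than from additive characters: if w · v = 1 and w · v′ = 0, then averaging along w sends g_v(x ·
-- v) to 0 and leaves g_v′(x · v′) fixed. The obstacle is that ‖_‖ may vanish on nonzero vectors, so
-- the component of v orthogonal to v′ need not supply such a w. All deviations are multiplied by q,
-- so the counting takes place in ℤ; division enters only when the final inequality is restated in
-- ℚ.

-- Finite sums of integers, indicators and weighted Cauchy-Schwarz.

module Sums where

  open import Data.Integer hiding (_≟_)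
  open import Data.Integer.Properties hiding (_≟_)
  open import Data.Integer.Tactic.RingSolver using (solve-∀)

  private variable
    A B : Set
    P Q   : Set

  0≤i*i : ∀ i → 0ℤ ≤ i * i
  0≤i*i (+ n)    = subst (0ℤ ≤_) (pos-* n n) (+≤+ z≤n)
  0≤i*i -[1+ n ] = +≤+ z≤n

  0≤i+j : ∀ {i j} → 0ℤ ≤ i → 0ℤ ≤ j → 0ℤ ≤ i + j
  0≤i+j = +-mono-≤

  *-monoˡ-≤ : ∀ {i j k} → 0ℤ ≤ i → j ≤ k → i * j ≤ i * k
  *-monoˡ-≤ {i} 0≤i = *-monoˡ-≤-nonNeg i {{nonNegative 0≤i}}

  *-monoʳ-≤ : ∀ {i j k} → 0ℤ ≤ k → i ≤ j → i * k ≤ j * k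
  *-monoʳ-≤ {k = k} 0≤k = *-monoʳ-≤-nonNeg k {{nonNegative 0≤k}}

  0≤i*j : ∀ {i j} → 0ℤ ≤ i → 0ℤ ≤ j → 0ℤ ≤ i * j
  0≤i*j {i} {j} 0≤i 0≤j = subst (_≤ i * j) (*-zeroʳ i) (*-monoˡ-≤ 0≤i 0≤j)

  ∑ : List A → (A → ℤ) → ℤ
  ∑ []       f = 0ℤ
  ∑ (x ∷ xs) f = f x + ∑ xs f

  ∑-cong : ∀ (xs : List A) {f g} → (∀ x → f x ≡ g x) → ∑ xs f ≡ ∑ xs g
  ∑-cong []       f≡g = refl
  ∑-cong (x ∷ xs) f≡g = cong₂ _+_ (f≡g x) (∑-cong xs f≡g)

  ∑-mono : ∀ (xs : List A) {f g} → (∀ x → f x ≤ g x) → ∑ xs f ≤ ∑ xs g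
  ∑-mono []       f≤g = ≤-refl
  ∑-mono (x ∷ xs) f≤g = +-mono-≤ (f≤g x) (∑-mono xs f≤g)

  ∑-nonneg : ∀ (xs : List A) {f} → (∀ x → 0ℤ ≤ f x) → 0ℤ ≤ ∑ xs f
  ∑-nonneg []       0≤f = ≤-refl
  ∑-nonneg (x ∷ xs) 0≤f = 0≤i+j (0≤f x) (∑-nonneg xs 0≤f)

  ∑-0 : ∀ (xs : List A) → ∑ xs (λ _ → 0ℤ) ≡ 0ℤ
  ∑-0 []       = refl
  ∑-0 (x ∷ xs) = trans (+-identityˡ _) (∑-0 xs)

  ∑-1 : ∀ (xs : List A) → ∑ xs (λ _ → 1ℤ) ≡ + length xs
  ∑-1 []       = refl
  ∑-1 (x ∷ xs) = cong (_+_ 1ℤ) (∑-1 xs)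

  ∑-+ : ∀ (xs : List A) f g → ∑ xs (λ x → f x + g x) ≡ ∑ xs f + ∑ xs g
  ∑-+ []       f g = refl
  ∑-+ (x ∷ xs) f g =
    trans (cong (_+_ (f x + g x)) (∑-+ xs f g)) (interchange (f x) (g x) _ _)
    where
    interchange : ∀ a b c d → a + b + (c + d) ≡ a + c + (b + d)
    interchange = solve-∀

  ∑-*ˡ : ∀ (xs : List A) c f → ∑ xs (λ x → c * f x) ≡ c * ∑ xs f
  ∑-*ˡ []       c f = sym (*-zeroʳ c)
  ∑-*ˡ (x ∷ xs) c f =
    trans (cong (_+_ (c * f x)) (∑-*ˡ xs c f)) (sym (*-distribˡ-+ c (f x) _))

  ∑-*ʳ : ∀ (xs : List A) c f → ∑ xs (λ x → f x * c) ≡ ∑ xs f * c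
  ∑-*ʳ xs c f = trans (∑-cong xs (λ x → *-comm (f x) c))
    (trans (∑-*ˡ xs c f) (*-comm c _))

  ∑-const : ∀ (xs : List A) c → ∑ xs (λ _ → c) ≡ c * + length xs
  ∑-const xs c = trans (∑-cong xs (λ _ → sym (*-identityʳ c)))
    (trans (∑-*ˡ xs c (λ _ → 1ℤ)) (cong (c *_) (∑-1 xs)))

  ∑-swap : ∀ (xs : List A) (ys : List B) (f : A → B → ℤ) →
           ∑ xs (λ x → ∑ ys (f x)) ≡ ∑ ys (λ y → ∑ xs (λ x → f x y))
  ∑-swap []       ys f = sym (∑-0 ys)
  ∑-swap (x ∷ xs) ys f =
    trans (cong (_+_ (∑ ys (f x))) (∑-swap xs ys f)) (sym (∑-+ ys (f x) _))

  ∑-++ : ∀ (xs ys : List A) f → ∑ (xs ++ ys) f ≡ ∑ xs f + ∑ ys f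
  ∑-++ []       ys f = sym (+-identityˡ _)
  ∑-++ (x ∷ xs) ys f =
    trans (cong (_+_ (f x)) (∑-++ xs ys f)) (sym (+-assoc (f x) _ _))

  ∑-map : ∀ (h : A → B) xs f → ∑ (map h xs) f ≡ ∑ xs (f ∘ h)
  ∑-map h []       f = refl
  ∑-map h (x ∷ xs) f = cong (_+_ (f (h x))) (∑-map h xs f)

  ∑-cartesianProduct : ∀ (xs : List A) (ys : List B) f →
    ∑ (cartesianProduct xs ys) f ≡ ∑ xs (λ x → ∑ ys (λ y → f (x , y)))
  ∑-cartesianProduct []       ys f = refl
  ∑-cartesianProduct (x ∷ xs) ys f = trans (∑-++ (map (x ,_) ys) _ f)
    (cong₂ _+_ (∑-map (x ,_) ys f) (∑-cartesianProduct xs ys f))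

  ∑*∑ : ∀ (xs : List A) (ys : List B) f g →
        ∑ xs f * ∑ ys g ≡ ∑ xs (λ x → ∑ ys (λ y → f x * g y))
  ∑*∑ xs ys f g = trans (sym (∑-*ʳ xs (∑ ys g) f))
    (∑-cong xs (λ x → sym (∑-*ˡ ys (f x) g)))

  𝟙 : Dec P → ℤ
  𝟙 P? = if does P? then 1ℤ else 0ℤ

  𝟙-yes : (P? : Dec P) → P → 𝟙 P? ≡ 1ℤ
  𝟙-yes (yes _) p = refl
  𝟙-yes (no ¬p) p = contradiction p ¬p

  𝟙-no : (P? : Dec P) → ¬ P → 𝟙 P? ≡ 0ℤ
  𝟙-no (yes p) ¬p = contradiction p ¬p
  𝟙-no (no _)  ¬p = refl

  𝟙-cong : (P? : Dec P) (Q? : Dec Q) → (P → Q) → (Q → P) → 𝟙 P? ≡ 𝟙 Q?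
  𝟙-cong (yes p) Q? f g = sym (𝟙-yes Q? (f p))
  𝟙-cong (no ¬p) Q? f g = sym (𝟙-no Q? (¬p ∘ g))

  0≤𝟙 : (P? : Dec P) → 0ℤ ≤ 𝟙 P?
  0≤𝟙 (yes _) = +≤+ z≤n
  0≤𝟙 (no _)  = ≤-refl

  𝟙≤1 : (P? : Dec P) → 𝟙 P? ≤ 1ℤ
  𝟙≤1 (yes _) = ≤-refl
  𝟙≤1 (no _)  = +≤+ z≤n

  𝟙*-cong : (P? : Dec P) {i j : ℤ} → (P → i ≡ j) → 𝟙 P? * i ≡ 𝟙 P? * j
  𝟙*-cong (yes p) i≡j = cong (1ℤ *_) (i≡j p)
  𝟙*-cong (no _)  i≡j = refl

  𝟙-⊎ : {R : Set} (P? : Dec P) (Q? : Dec Q) (R? : Dec R) →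
        (P → Q ⊎ R) → 𝟙 P? ≤ 𝟙 Q? + 𝟙 R?
  𝟙-⊎ (no _)  Q? R? f = 0≤i+j (0≤𝟙 Q?) (0≤𝟙 R?)
  𝟙-⊎ (yes p) Q? R? f with f p
  ... | inj₁ q = +-mono-≤ (≤-reflexive (sym (𝟙-yes Q? q))) (0≤𝟙 R?)
  ... | inj₂ r = +-mono-≤ (0≤𝟙 Q?) (≤-reflexive (sym (𝟙-yes R? r)))

  length-filter : {P : Pred A 0ℓ} (P? : Decidable P) → ∀ xs →
                  + length (filter P? xs) ≡ ∑ xs (𝟙 ∘ P?)
  length-filter P? []       = refl
  length-filter P? (x ∷ xs) with does (P? x)
  ... | true  = cong (_+_ 1ℤ) (length-filter P? xs)
  ... | false = trans (length-filter P? xs) (sym (+-identityˡ _))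

  record IsEnumeration (xs : List A) : Set where
    field
      _≟_      : DecidableEquality A
      unique   : Unique xs
      complete : ∀ x → x ∈ xs

    infix 4 _≟_

    ∑-δ : ∀ a f → ∑ xs (λ x → 𝟙 (x ≟ a) * f x) ≡ f a
    ∑-δ a f = present xs unique (complete a)
      where
      absent : ∀ ys → All (a ≢_) ys → ∑ ys (λ x → 𝟙 (x ≟ a) * f x) ≡ 0ℤ
      absent []       []            = refl
      absent (y ∷ ys) (a≢y ∷ a∉ys) =
        cong₂ _+_ (cong (_* f y) (𝟙-no (y ≟ a) (a≢y ∘ sym))) (absent ys a∉ys)

      present : ∀ ys → Unique ys → a ∈ ys →
                ∑ ys (λ x → 𝟙 (x ≟ a) * f x) ≡ f a
      present (y ∷ ys) (y∉ys ∷ uniq) (here refl) = begin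
        𝟙 (y ≟ y) * f y + _ ≡⟨ cong₂ _+_ (cong (_* f y) (𝟙-yes (y ≟ y) refl))
                                         (absent ys y∉ys) ⟩
        1ℤ * f y + 0ℤ       ≡⟨ +-identityʳ _ ⟩
        1ℤ * f y            ≡⟨ *-identityˡ (f y) ⟩
        f y                 ∎
        where open ≡-Reasoning
      present (y ∷ ys) (y∉ys ∷ uniq) (there a∈ys) =
        trans (cong₂ _+_ (cong (_* f y) (𝟙-no (y ≟ a) (All.lookup y∉ys a∈ys)))
                         (present ys uniq a∈ys))
              (+-identityˡ (f a))

    -- Expanding `h (f x)` against the indicator of `y ≡ f x` and exchanging the sums turns the
    -- claim into a count over the graph of `f`, so no permutation of `xs` has to be exhibited.
    ∑-bijection : (f g : A → A) → (∀ x → g (f x) ≡ x) → (∀ x → f (g x) ≡ x) →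
                  ∀ h → ∑ xs (h ∘ f) ≡ ∑ xs h
    ∑-bijection f g gf fg h = begin
      ∑ xs (h ∘ f)
        ≡⟨ ∑-cong xs (λ x → sym (∑-δ (f x) h)) ⟩
      ∑ xs (λ x → ∑ xs (λ y → 𝟙 (y ≟ f x) * h y))
        ≡⟨ ∑-swap xs xs _ ⟩
      ∑ xs (λ y → ∑ xs (λ x → 𝟙 (y ≟ f x) * h y))
        ≡⟨ ∑-cong xs (λ y → ∑-cong xs (λ x → cong (_* h y)
             (𝟙-cong (y ≟ f x) (x ≟ g y)
               (λ y≡fx → trans (sym (gf x)) (cong g (sym y≡fx)))
               (λ x≡gy → trans (sym (fg y)) (cong f (sym x≡gy)))))) ⟩
      ∑ xs (λ y → ∑ xs (λ x → 𝟙 (x ≟ g y) * h y))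
        ≡⟨ ∑-cong xs (λ y → ∑-δ (g y) (λ _ → h y)) ⟩
      ∑ xs h ∎
      where open ≡-Reasoning

  module CauchySchwarz (w : A → ℤ) (0≤w : ∀ x → 0ℤ ≤ w x) (b : A → ℤ) where

    -- The expression is the expansion of the sum of w (b - c)².
    second-moment : ∀ c xs → 0ℤ ≤ ∑ xs (λ x → w x * (b x * b x))
      - (+ 2 * c * ∑ xs (λ x → w x * b x)) + c * c * ∑ xs w
    second-moment c []       = ≤-reflexive (sym (vanish c))
      where
      vanish : ∀ c → 0ℤ - (+ 2 * c * 0ℤ) + c * c * 0ℤ ≡ 0ℤ
      vanish = solve-∀
    second-moment c (x ∷ xs) = subst (0ℤ ≤_) (step (w x) (b x) c _ _ _)
      (0≤i+j (0≤i*j (0≤w x) (0≤i*i (b x - c))) (second-moment c xs))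
      where
      step : ∀ w b c C B A →
        w * ((b - c) * (b - c)) + (C - (+ 2 * c * B) + c * c * A)
        ≡ w * (b * b) + C - (+ 2 * c * (w * b + B)) + c * c * (w + A)
      step = solve-∀

    -- Adding an entry x raises the difference of the two sides by w(x) times the sum of w (b -
    -- b(x))² over the remaining entries, which is `second-moment` at c = b(x).
    cauchy-schwarz : ∀ xs →
      ∑ xs (λ x → w x * b x) * ∑ xs (λ x → w x * b x)
      ≤ ∑ xs w * ∑ xs (λ x → w x * (b x * b x))
    cauchy-schwarz []       = ≤-refl
    cauchy-schwarz (x ∷ xs) = 0≤i-j⇒j≤i (subst (0ℤ ≤_) (step (w x) (b x) _ _ _)
      (0≤i+j (i≤j⇒0≤j-i (cauchy-schwarz xs))
             (0≤i*j (0≤w x) (second-moment (b x) xs))))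
      where
      step : ∀ w b C B A →
        A * C - B * B + w * (C - (+ 2 * b * B) + b * b * A)
        ≡ (w + A) * (w * (b * b) + C) - (w * b + B) * (w * b + B)
      step = solve-∀

  open CauchySchwarz public using (cauchy-schwarz)

-- Arithmetic in the field.

module FieldProperties {q : ℕ} (𝔽 : FiniteField q) where
  open FiniteField 𝔽

  commutativeRing : CommutativeRing 0ℓ 0ℓ
  commutativeRing = record { isCommutativeRing = isCommutativeRing }

  open CommutativeRing commutativeRing public
    using ( +-comm; +-assoc; +-identityˡ; +-identityʳ; -‿inverseˡ; -‿inverseʳ
          ; *-comm; *-assoc; *-identityˡ; *-identityʳ; zeroˡ; zeroʳ
          ; distribʳ)
  open Algebra.Properties.Ring (CommutativeRing.ring commutativeRing) public
    using ( -‿distribˡ-*; -‿distribʳ-*; -‿involutive; -‿+-comm; -0#≈0#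
          ; +-inverseˡ-unique; +-cancelˡ; +-cancelʳ)
  open SemiringSolver (CommutativeRing.commutativeSemiring commutativeRing) public
    using (solve; _:=_; _:+_; _:*_)

  +-+ʳ- : ∀ x y → (x + y) + - y ≡ x
  +-+ʳ- x y = trans (+-assoc x y (- y))
    (trans (cong (x +_) (-‿inverseʳ y)) (+-identityʳ x))

  +--ʳ+ : ∀ x y → (x + - y) + y ≡ x
  +--ʳ+ x y = trans (+-assoc x (- y) y)
    (trans (cong (x +_) (-‿inverseˡ y)) (+-identityʳ x))

  x-y≡0⇒x≡y : ∀ {x y} → x + - y ≡ 0# → x ≡ y
  x-y≡0⇒x≡y {x} {y} x-y≡0 =
    trans (sym (+--ʳ+ x y)) (trans (cong (_+ y) x-y≡0) (+-identityˡ y))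

  *-cancelˡ : ∀ {a x y} → a ≢ 0# → a * x ≡ a * y → x ≡ y
  *-cancelˡ {a} {x} {y} a≢0 ax≡ay with inverse a a≢0
  ... | b , ab≡1 = begin
    x           ≡⟨ *-identityˡ x ⟨
    1# * x      ≡⟨ cong (_* x) ab≡1 ⟨
    a * b * x   ≡⟨ swap a b x ⟩
    b * (a * x) ≡⟨ cong (b *_) ax≡ay ⟩
    b * (a * y) ≡⟨ swap a b y ⟨
    a * b * y   ≡⟨ cong (_* y) ab≡1 ⟩
    1# * y      ≡⟨ *-identityˡ y ⟩
    y           ∎
    where
    open ≡-Reasoning
    swap : ∀ a b x → a * b * x ≡ b * (a * x)
    swap = solve 3 (λ a b x → a :* b :* x := b :* (a :* x)) refl

  x*y≡0⇒y≡0 : ∀ {x y} → x ≢ 0# → x * y ≡ 0# → y ≡ 0#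
  x*y≡0⇒y≡0 {x} x≢0 xy≡0 = *-cancelˡ x≢0 (trans xy≡0 (sym (zeroʳ x)))

  x*x≡0⇒x≡0 : ∀ {x} → x * x ≡ 0# → x ≡ 0#
  x*x≡0⇒x≡0 {x} xx≡0 with x ≟ 0#
  ... | yes x≡0 = x≡0
  ... | no  x≢0 = x*y≡0⇒y≡0 x≢0 xx≡0

  x²≡y²⇒x≡±y : ∀ {x y} → x * x ≡ y * y → x ≡ y ⊎ x ≡ - y
  x²≡y²⇒x≡±y {x} {y} x²≡y² with x + - y ≟ 0#
  ... | yes x-y≡0 = inj₁ (x-y≡0⇒x≡y x-y≡0)
  ... | no  x-y≢0 = inj₂ (+-inverseˡ-unique x y (x*y≡0⇒y≡0 x-y≢0 (begin
    (x + - y) * (x + y)         ≡⟨ expand x y (- y) ⟩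
    x * x + - y * y + (y + - y) * x
      ≡⟨ cong₂ _+_ (cong₂ _+_ x²≡y² (sym (-‿distribˡ-* y y)))
                   (trans (cong (_* x) (-‿inverseʳ y)) (zeroˡ x)) ⟩
    y * y + - (y * y) + 0#      ≡⟨ +-identityʳ _ ⟩
    y * y + - (y * y)           ≡⟨ -‿inverseʳ _ ⟩
    0#                          ∎)))
    where
    open ≡-Reasoning
    -- A semiring identity in which z stands for `- y`; the last term then has the factor y + - y
    -- and vanishes.
    expand : ∀ x y z → (x + z) * (x + y) ≡ x * x + z * y + (y + z) * x
    expand = solve 3 (λ x y z →
      (x :+ z) :* (x :+ y) := x :* x :+ z :* y :+ (y :+ z) :* x) refl

-- The dot product, separation of directions, and invariance of the offset.

module Algebraic {q : ℕ} (𝔽 : FiniteField q) (d : ℕ) where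
  open FiniteField 𝔽
  open Geometry 𝔽 d
  open FieldProperties 𝔽

  ·-comm : ∀ {n} (x y : Vec Carrier n) → x · y ≡ y · x
  ·-comm []      []      = refl
  ·-comm (a ∷ x) (b ∷ y) = cong₂ _+_ (*-comm a b) (·-comm x y)

  ·-+ˡ : ∀ {n} (x y z : Vec Carrier n) → (x +ᵥ y) · z ≡ x · z + y · z
  ·-+ˡ []      []      []      = sym (+-identityˡ 0#)
  ·-+ˡ (a ∷ x) (b ∷ y) (c ∷ z) =
    trans (cong ((a + b) * c +_) (·-+ˡ x y z)) (rearrange a b c _ _)
    where
    rearrange : ∀ a b c s t → (a + b) * c + (s + t) ≡ a * c + s + (b * c + t)
    rearrange = solve 5 (λ a b c s t →
      (a :+ b) :* c :+ (s :+ t) := a :* c :+ s :+ (b :* c :+ t)) refl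

  ·-*ˡ : ∀ {n} c (x y : Vec Carrier n) → (c *ᵥ x) · y ≡ c * (x · y)
  ·-*ˡ c []      []      = sym (zeroʳ c)
  ·-*ˡ c (a ∷ x) (b ∷ y) =
    trans (cong (c * a * b +_) (·-*ˡ c x y)) (rearrange c a b _)
    where
    rearrange : ∀ c a b s → c * a * b + c * s ≡ c * (a * b + s)
    rearrange = solve 4 (λ c a b s →
      c :* a :* b :+ c :* s := c :* (a :* b :+ s)) refl

  ·-+ʳ : ∀ {n} (x y z : Vec Carrier n) → x · (y +ᵥ z) ≡ x · y + x · z
  ·-+ʳ x y z = trans (·-comm x (y +ᵥ z))
    (trans (·-+ˡ y z x) (cong₂ _+_ (·-comm y x) (·-comm z x)))

  ·-*ʳ : ∀ {n} c (x y : Vec Carrier n) → x · (c *ᵥ y) ≡ c * (x · y)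
  ·-*ʳ c x y = trans (·-comm x (c *ᵥ y))
    (trans (·-*ˡ c y x) (cong (c *_) (·-comm y x)))

  ·--ˡ : ∀ {n} (x y : Vec Carrier n) → (-ᵥ x) · y ≡ - (x · y)
  ·--ˡ []      []      = sym -0#≈0#
  ·--ˡ (a ∷ x) (b ∷ y) =
    trans (cong₂ _+_ (sym (-‿distribˡ-* a b)) (·--ˡ x y)) (-‿+-comm (a * b) _)

  +ᵥ-comm : ∀ {n} (x y : Vec Carrier n) → x +ᵥ y ≡ y +ᵥ x
  +ᵥ-comm []      []      = refl
  +ᵥ-comm (a ∷ x) (b ∷ y) = cong₂ _∷_ (+-comm a b) (+ᵥ-comm x y)

  +ᵥ-assoc : ∀ {n} (x y z : Vec Carrier n) → (x +ᵥ y) +ᵥ z ≡ x +ᵥ (y +ᵥ z)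
  +ᵥ-assoc []      []      []      = refl
  +ᵥ-assoc (a ∷ x) (b ∷ y) (c ∷ z) = cong₂ _∷_ (+-assoc a b c) (+ᵥ-assoc x y z)

  +ᵥ-−ᵥ : ∀ {n} (x y : Vec Carrier n) → (x +ᵥ y) -ᵥ y ≡ x
  +ᵥ-−ᵥ []      []      = refl
  +ᵥ-−ᵥ (a ∷ x) (b ∷ y) = cong₂ _∷_ (+-+ʳ- a b) (+ᵥ-−ᵥ x y)

  −ᵥ-+ᵥ : ∀ {n} (x y : Vec Carrier n) → (x -ᵥ y) +ᵥ y ≡ x
  −ᵥ-+ᵥ []      []      = refl
  −ᵥ-+ᵥ (a ∷ x) (b ∷ y) = cong₂ _∷_ (+--ʳ+ a b) (−ᵥ-+ᵥ x y)

  +ᵥ-cancelʳ : ∀ {n} (x y z : Vec Carrier n) → x +ᵥ z ≡ y +ᵥ z → x ≡ y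
  +ᵥ-cancelʳ x y z eq =
    trans (sym (+ᵥ-−ᵥ x z)) (trans (cong (_-ᵥ z) eq) (+ᵥ-−ᵥ y z))

  *ᵥ-cancelˡ : ∀ {n a} {x y : Vec Carrier n} → a ≢ 0# → a *ᵥ x ≡ a *ᵥ y → x ≡ y
  *ᵥ-cancelˡ {x = []}    {[]}    a≢0 eq = refl
  *ᵥ-cancelˡ {x = b ∷ x} {c ∷ y} a≢0 eq =
    cong₂ _∷_ (*-cancelˡ a≢0 (cong Vec.head eq)) (*ᵥ-cancelˡ a≢0 (cong Vec.tail eq))

  -*ᵥ : ∀ {n} a (x : Vec Carrier n) → (- a) *ᵥ x ≡ a *ᵥ (-ᵥ x)
  -*ᵥ a []      = refl
  -*ᵥ a (b ∷ x) =
    cong₂ _∷_ (trans (sym (-‿distribˡ-* a b)) (-‿distribʳ-* a b)) (-*ᵥ a x)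

  x+-a*y≡0⇒x≡a*y : ∀ {n} a (x y : Vec Carrier n) →
                    x +ᵥ (- a) *ᵥ y ≡ 0ᵥ → x ≡ a *ᵥ y
  x+-a*y≡0⇒x≡a*y a []      []      eq = refl
  x+-a*y≡0⇒x≡a*y a (b ∷ x) (c ∷ y) eq = cong₂ _∷_
    (x-y≡0⇒x≡y (trans (cong (b +_) (-‿distribˡ-* a c)) (cong Vec.head eq)))
    (x+-a*y≡0⇒x≡a*y a x y (cong Vec.tail eq))

  0ᵥ-· : ∀ {n} (x : Vec Carrier n) → 0ᵥ · x ≡ 0#
  0ᵥ-· []      = refl
  0ᵥ-· (a ∷ x) = trans (cong₂ _+_ (zeroˡ a) (0ᵥ-· x)) (+-identityˡ 0#)

  -- The witness carries the inverse of the first nonzero coordinate of z in that position and zeros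
  -- elsewhere.
  ·-nondegenerate : ∀ {n} (z : Vec Carrier n) → z ≢ 0ᵥ → ∃ λ y → y · z ≡ 1#
  ·-nondegenerate []      z≢0 = contradiction refl z≢0
  ·-nondegenerate (a ∷ z) z≢0 with a ≟ 0#
  ... | no a≢0 = let b , ab≡1 = inverse a a≢0 in
    b ∷ 0ᵥ , trans (cong₂ _+_ (trans (*-comm b a) ab≡1) (0ᵥ-· z)) (+-identityʳ 1#)
  ... | yes refl = let y , yz≡1 = ·-nondegenerate z (z≢0 ∘ cong (0# ∷_)) in
    0# ∷ y , trans (cong₂ _+_ (zeroˡ 0#) yz≡1) (+-identityˡ 1#)

  ‖v‖≢0⇒dual : ∀ (v : Point) → ‖ v ‖ ≢ 0# → ∃ λ w → w · v ≡ 1#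
  ‖v‖≢0⇒dual v ‖v‖≢0 = let b , vb≡1 = inverse ‖ v ‖ ‖v‖≢0 in
    b *ᵥ v , trans (·-*ˡ b v v) (trans (*-comm b ‖ v ‖) vb≡1)

  -- The translate of `H v t` by -x is `H v s` with s the offset.
  offset : Point × Params → Carrier
  offset (x , v , t) = t + - (x · v)

  module _ {γ : Carrier} (γ≢0 : γ ≢ 0#) (¬□γ : ¬ IsSquare γ) where

    norm≢0 : ∀ v → NormOneOr γ v → ‖ v ‖ ≢ 0#
    norm≢0 v (inj₁ ‖v‖≡1) ‖v‖≡0 = 0≢1 (trans (sym ‖v‖≡0) ‖v‖≡1)
    norm≢0 v (inj₂ ‖v‖≡γ) ‖v‖≡0 = γ≢0 (trans (sym ‖v‖≡γ) ‖v‖≡0)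

    -- 1 and γ represent different classes modulo squares.
    norms-agree : ∀ v v′ → NormOneOr γ v → NormOneOr γ v′ →
                  IsSquare (‖ v ‖ * ‖ v′ ‖) → ‖ v ‖ ≡ ‖ v′ ‖
    norms-agree v v′ (inj₁ e) (inj₁ e′) □ = trans e (sym e′)
    norms-agree v v′ (inj₂ e) (inj₂ e′) □ = trans e (sym e′)
    norms-agree v v′ (inj₁ e) (inj₂ e′) (z , z²≡) = contradiction
      (z , trans z²≡ (trans (cong₂ _*_ e e′) (*-identityˡ γ))) ¬□γ
    norms-agree v v′ (inj₂ e) (inj₁ e′) (z , z²≡) = contradiction
      (z , trans z²≡ (trans (cong₂ _*_ e e′) (*-identityʳ γ))) ¬□γ

    -- Pairing the hypothesis with v gives (v · v′)² = ‖v‖ ‖v′‖. This product is therefore a square,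
    -- so the norms agree and v · v′ = ± ‖v′‖; cancelling ‖v′‖ in the hypothesis finishes.
    parallel⇒± : ∀ v v′ → NormOneOr γ v → NormOneOr γ v′ →
                 ‖ v′ ‖ *ᵥ v ≡ (v · v′) *ᵥ v′ → v ≡ v′ ⊎ v ≡ -ᵥ v′
    parallel⇒± v v′ nv nv′ par with x²≡y²⇒x≡±y p²≡N²
      where
      open ≡-Reasoning
      N = ‖ v ‖
      N′ = ‖ v′ ‖
      p = v · v′
      N′≢0 = norm≢0 v′ nv′
      p²≡NN′ : p * p ≡ N * N′
      p²≡NN′ = begin
        p * p                ≡⟨ cong (p *_) (·-comm v v′) ⟩
        p * (v′ · v)         ≡⟨ ·-*ˡ p v′ v ⟨
        (p *ᵥ v′) · v        ≡⟨ cong (_· v) par ⟨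
        (N′ *ᵥ v) · v        ≡⟨ ·-*ˡ N′ v v ⟩
        N′ * N               ≡⟨ *-comm N′ N ⟩
        N * N′               ∎
      p²≡N² : p * p ≡ N′ * N′
      p²≡N² = trans p²≡NN′ (cong (_* N′) (norms-agree v v′ nv nv′ (p , p²≡NN′)))
    ... | inj₁ p≡N  = inj₁ (*ᵥ-cancelˡ (norm≢0 v′ nv′) (trans par (cong (_*ᵥ v′) p≡N)))
    ... | inj₂ p≡-N = inj₂ (*ᵥ-cancelˡ (norm≢0 v′ nv′)
      (trans par (trans (cong (_*ᵥ v′) p≡-N) (-*ᵥ ‖ v′ ‖ v′))))

    -- Up to the factor N′, z is the component of v orthogonal to v′, nonzero because v and v′ are
    -- not parallel. It may be isotropic, since ‖z‖ = N′ (N′ ‖v‖ - p²), so z · v can vanish and z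
    -- itself cannot serve. Instead some y has y · z = 1, and w is the same projection applied to y:
    -- w · v′ = 0, and w · v = y · z because the projection is self-adjoint.
    separate : ∀ v v′ → NormOneOr γ v → NormOneOr γ v′ →
               v ≢ v′ → v ≢ -ᵥ v′ → ∃ λ w → w · v ≡ 1# × w · v′ ≡ 0#
    separate v v′ nv nv′ v≢v′ v≢-v′ = w , w·v≡1 , w·v′≡0
      where
      open ≡-Reasoning
      N′ = ‖ v′ ‖
      p  = v · v′
      z : Point
      z = N′ *ᵥ v +ᵥ (- p) *ᵥ v′
      z≢0 : z ≢ 0ᵥ
      z≢0 z≡0 with parallel⇒± v v′ nv nv′ (x+-a*y≡0⇒x≡a*y p (N′ *ᵥ v) v′ z≡0)
      ... | inj₁ v≡v′  = v≢v′ v≡v′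
      ... | inj₂ v≡-v′ = v≢-v′ v≡-v′
      y : Point
      y = proj₁ (·-nondegenerate z z≢0)
      w : Point
      w = N′ *ᵥ y +ᵥ (- (y · v′)) *ᵥ v′
      w· : ∀ u → w · u ≡ N′ * (y · u) + - (y · v′) * (v′ · u)
      w· u = trans (·-+ˡ (N′ *ᵥ y) _ u)
        (cong₂ _+_ (·-*ˡ N′ y u) (·-*ˡ (- (y · v′)) v′ u))
      w·v≡1 : w · v ≡ 1#
      w·v≡1 = begin
        w · v                                    ≡⟨ w· v ⟩
        N′ * (y · v) + - (y · v′) * (v′ · v)     ≡⟨ cong (N′ * (y · v) +_) flip ⟩
        N′ * (y · v) + - p * (y · v′)            ≡⟨ cong₂ _+_ (·-*ʳ N′ y v) (·-*ʳ (- p) y v′) ⟨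
        y · (N′ *ᵥ v) + y · ((- p) *ᵥ v′)        ≡⟨ ·-+ʳ y (N′ *ᵥ v) _ ⟨
        y · z                                    ≡⟨ proj₂ (·-nondegenerate z z≢0) ⟩
        1#                                       ∎
        where
        flip : - (y · v′) * (v′ · v) ≡ - p * (y · v′)
        flip = begin
          - (y · v′) * (v′ · v)   ≡⟨ -‿distribˡ-* _ _ ⟨
          - ((y · v′) * (v′ · v)) ≡⟨ cong -_ (*-comm _ _) ⟩
          - ((v′ · v) * (y · v′)) ≡⟨ cong (λ c → - (c * (y · v′))) (·-comm v′ v) ⟩
          - (p * (y · v′))        ≡⟨ -‿distribˡ-* _ _ ⟩
          - p * (y · v′)          ∎
      w·v′≡0 : w · v′ ≡ 0#
      w·v′≡0 = begin
        w · v′                                   ≡⟨ w· v′ ⟩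
        N′ * (y · v′) + - (y · v′) * N′          ≡⟨ cong₂ _+_ (*-comm N′ _) (sym (-‿distribˡ-* _ N′)) ⟩
        (y · v′) * N′ + - ((y · v′) * N′)        ≡⟨ -‿inverseʳ _ ⟩
        0#                                       ∎

    module _ (1≢-1 : 1# ≢ - 1#) where

      x+x≡0⇒x≡0 : ∀ {x} → x + x ≡ 0# → x ≡ 0#
      x+x≡0⇒x≡0 {x} x+x≡0 = x*y≡0⇒y≡0 {1# + 1#}
        (λ 1+1≡0 → 1≢-1 (+-inverseˡ-unique 1# 1# 1+1≡0))
        (trans (distribʳ x 1# 1#) (trans (cong₂ _+_ (*-identityˡ x) (*-identityˡ x)) x+x≡0))

      ‖+‖ : ∀ {n} (x y : Vec Carrier n) →
            ‖ x +ᵥ y ‖ ≡ ‖ x ‖ + ‖ y ‖ + (x · y + x · y)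
      ‖+‖ x y = begin
        (x +ᵥ y) · (x +ᵥ y)                   ≡⟨ ·-+ˡ x y _ ⟩
        x · (x +ᵥ y) + y · (x +ᵥ y)           ≡⟨ cong₂ _+_ (·-+ʳ x x y) (·-+ʳ y x y) ⟩
        x · x + x · y + (y · x + y · y)       ≡⟨ cong (λ c → x · x + x · y + (c + y · y)) (·-comm y x) ⟩
        x · x + x · y + (x · y + y · y)       ≡⟨ rearrange _ _ _ ⟩
        ‖ x ‖ + ‖ y ‖ + (x · y + x · y)       ∎
        where
        open ≡-Reasoning
        rearrange : ∀ a b c → a + b + (b + c) ≡ a + c + (b + b)
        rearrange = solve 3 (λ a b c → a :+ b :+ (b :+ c) := a :+ c :+ (b :+ b)) refl

      -- Polarisation: θ preserves the norms of x, y and x + y, hence twice the dot product, and 2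
      -- is nonzero because 1 ≠ -1.
      orthogonal-reflects-⊥ : ∀ {θ} → IsOrthogonal θ → ∀ x y →
                              θ x · θ y ≡ 0# → x · y ≡ 0#
      orthogonal-reflects-⊥ {θ} (mkOrthogonal lin norm) x y θxθy≡0 =
        x+x≡0⇒x≡0 (+-cancelˡ (‖ x ‖ + ‖ y ‖) _ _ (begin
          ‖ x ‖ + ‖ y ‖ + (x · y + x · y)               ≡⟨ ‖+‖ x y ⟨
          ‖ x +ᵥ y ‖                                    ≡⟨ norm (x +ᵥ y) ⟨
          ‖ θ (x +ᵥ y) ‖                                ≡⟨ cong ‖_‖ (IsLinear.+-homo lin x y) ⟩
          ‖ θ x +ᵥ θ y ‖                                ≡⟨ ‖+‖ (θ x) (θ y) ⟩
          ‖ θ x ‖ + ‖ θ y ‖ + (θ x · θ y + θ x · θ y)   ≡⟨ cong₂ _+_ (cong₂ _+_ (norm x) (norm y))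
                                                             (trans (cong₂ _+_ θxθy≡0 θxθy≡0) (+-identityˡ 0#)) ⟩
          ‖ x ‖ + ‖ y ‖ + 0#                            ∎))
        where open ≡-Reasoning

      -- The point z of h - x that θ sends to the foot of the perpendicular from
      -- the origin to h′ - x′ is itself the foot of the perpendicular to h - x.
      ∼⇒offset² : ∀ x v t x′ v′ t′ → ‖ v′ ‖ ≢ 0# → (x , v , t) ∼ (x′ , v′ , t′) →
        let s = offset (x , v , t); s′ = offset (x′ , v′ , t′) in
        s * s * ‖ v′ ‖ ≡ s′ * s′ * ‖ v ‖
      ∼⇒offset² x v t x′ v′ t′ N′≢0 (θ , orth , into , onto) = begin
        s * s * N′             ≡⟨ cong (_* N′) N‖z‖≡s² ⟨
        N * ‖ z ‖ * N′         ≡⟨ cong (λ c → N * c * N′) ‖z‖≡ ⟩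
        N * (a * s′) * N′      ≡⟨ rearrange N a s′ N′ ⟩
        s′ * (a * N′) * N      ≡⟨ cong (λ c → s′ * c * N) aN′≡s′ ⟩
        s′ * s′ * N            ∎
        where
        open ≡-Reasoning
        open IsOrthogonal orth
        N = ‖ v ‖
        N′ = ‖ v′ ‖
        s = offset (x , v , t)
        s′ = offset (x′ , v′ , t′)
        rearrange : ∀ N a s N′ → N * (a * s) * N′ ≡ s * (a * N′) * N
        rearrange = solve 4 (λ N a s N′ → N :* (a :* s) :* N′ := s :* (a :* N′) :* N) refl
        -- a = s′ / N′, so that a v′ has product s′ with v′ and hence lies on h′ - x′.
        a = s′ * proj₁ (inverse N′ N′≢0)
        aN′≡s′ : a * N′ ≡ s′
        aN′≡s′ = trans (*-assoc s′ _ N′)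
          (trans (cong (s′ *_) (trans (*-comm _ N′) (proj₂ (inverse N′ N′≢0)))) (*-identityʳ s′))
        foot = a *ᵥ v′
        foot∈h′ : (foot +ᵥ x′) · v′ ≡ t′
        foot∈h′ = trans (·-+ˡ foot x′ v′)
          (trans (cong (_+ x′ · v′) (trans (·-*ˡ a v′ v′) aN′≡s′)) (+--ʳ+ t′ _))
        preimage = onto foot∈h′
        y = proj₁ preimage
        z = y -ᵥ x
        θz≡foot : θ z ≡ foot
        θz≡foot = +ᵥ-cancelʳ (θ z) foot x′ (proj₂ (proj₂ preimage))
        z·v≡s : z · v ≡ s
        z·v≡s = trans (·-+ˡ y (-ᵥ x) v)
          (cong₂ _+_ (proj₁ (proj₂ preimage)) (·--ˡ x v))
        ‖z‖≡ : ‖ z ‖ ≡ a * s′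
        ‖z‖≡ = begin
          ‖ z ‖          ≡⟨ norm z ⟨
          ‖ θ z ‖        ≡⟨ cong ‖_‖ θz≡foot ⟩
          ‖ foot ‖       ≡⟨ ·-*ˡ a v′ foot ⟩
          a * (v′ · foot) ≡⟨ cong (a *_) (trans (·-*ʳ a v′ v′) aN′≡s′) ⟩
          a * s′         ∎
        -- N times the component of z orthogonal to v. As u · v = 0, the point y + u stays in h; its
        -- image lies in h′, which forces θ u ⊥ v′ and so θ u ⊥ θ z. Pulled back, z · u = 0 reads N
        -- ‖z‖ = s².
        u = N *ᵥ z +ᵥ (- s) *ᵥ v
        ·u : ∀ x → x · u ≡ N * (x · z) + - s * (x · v)
        ·u x = trans (·-+ʳ x (N *ᵥ z) _) (cong₂ _+_ (·-*ʳ N x z) (·-*ʳ (- s) x v))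
        u·v≡0 : u · v ≡ 0#
        u·v≡0 = begin
          u · v                   ≡⟨ ·-comm u v ⟩
          v · u                   ≡⟨ ·u v ⟩
          N * (v · z) + - s * N   ≡⟨ cong₂ _+_ (cong (N *_) (trans (·-comm v z) z·v≡s)) (sym (-‿distribˡ-* s N)) ⟩
          N * s + - (s * N)       ≡⟨ cong (λ c → c + - (s * N)) (*-comm N s) ⟩
          s * N + - (s * N)       ≡⟨ -‿inverseʳ _ ⟩
          0#                      ∎
        y+u∈h : (y +ᵥ u) · v ≡ t
        y+u∈h = trans (·-+ˡ y u v)
          (trans (cong₂ _+_ (proj₁ (proj₂ preimage)) u·v≡0) (+-identityʳ t))
        shift : (y +ᵥ u) -ᵥ x ≡ u +ᵥ z
        shift = trans (cong (_-ᵥ x) (+ᵥ-comm y u)) (+ᵥ-assoc u y (-ᵥ x))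
        θu⊥v′ : θ u · v′ ≡ 0#
        θu⊥v′ = +-cancelʳ t′ _ _ (begin
          θ u · v′ + t′                     ≡⟨ cong (θ u · v′ +_) foot∈h′ ⟨
          θ u · v′ + (foot +ᵥ x′) · v′      ≡⟨ ·-+ˡ (θ u) (foot +ᵥ x′) v′ ⟨
          (θ u +ᵥ (foot +ᵥ x′)) · v′        ≡⟨ cong (_· v′) (+ᵥ-assoc (θ u) foot x′) ⟨
          (θ u +ᵥ foot +ᵥ x′) · v′          ≡⟨ cong (λ p → (θ u +ᵥ p +ᵥ x′) · v′) θz≡foot ⟨
          (θ u +ᵥ θ z +ᵥ x′) · v′           ≡⟨ cong (λ p → (p +ᵥ x′) · v′) (IsLinear.+-homo isLinear u z) ⟨
          (θ (u +ᵥ z) +ᵥ x′) · v′           ≡⟨ into (y +ᵥ u , y+u∈h , cong (λ p → θ p +ᵥ x′) shift) ⟩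
          t′                                ≡⟨ +-identityˡ t′ ⟨
          0# + t′                           ∎)
        z⊥u : z · u ≡ 0#
        z⊥u = orthogonal-reflects-⊥ orth z u (begin
          θ z · θ u           ≡⟨ cong (_· θ u) θz≡foot ⟩
          foot · θ u          ≡⟨ ·-*ˡ a v′ (θ u) ⟩
          a * (v′ · θ u)      ≡⟨ cong (a *_) (trans (·-comm v′ (θ u)) θu⊥v′) ⟩
          a * 0#              ≡⟨ zeroʳ a ⟩
          0#                  ∎)
        N‖z‖≡s² : N * ‖ z ‖ ≡ s * s
        N‖z‖≡s² = x-y≡0⇒x≡y (begin
          N * ‖ z ‖ + - (s * s)         ≡⟨ cong (N * ‖ z ‖ +_) (-‿distribˡ-* s s) ⟩
          N * ‖ z ‖ + - s * s           ≡⟨ cong (λ c → N * ‖ z ‖ + - s * c) z·v≡s ⟨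
          N * ‖ z ‖ + - s * (z · v)     ≡⟨ ·u z ⟨
          z · u                         ≡⟨ z⊥u ⟩
          0#                            ∎)

      -- If s ≠ 0, the relation s² ‖v′‖ = s′² ‖v‖ exhibits ‖v‖ ‖v′‖ as a square, so the norms agree
      -- and can be cancelled. If s = 0, then s′ = 0 as well, since ‖v‖ ≠ 0.
      ∼⇒offset± : ∀ p p′ → NormOneOr γ (proj₁ (proj₂ p)) → NormOneOr γ (proj₁ (proj₂ p′)) →
                  p ∼ p′ → offset p ≡ offset p′ ⊎ offset p ≡ - offset p′
      ∼⇒offset± (x , v , t) (x′ , v′ , t′) nv nv′ p∼p′ =
        conclude (∼⇒offset² x v t x′ v′ t′ (norm≢0 v′ nv′) p∼p′)
        where
        open ≡-Reasoning
        N = ‖ v ‖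
        N′ = ‖ v′ ‖
        s = offset (x , v , t)
        s′ = offset (x′ , v′ , t′)
        conclude : s * s * N′ ≡ s′ * s′ * N → s ≡ s′ ⊎ s ≡ - s′
        conclude eq with s ≟ 0#
        ... | yes s≡0 = inj₁ (trans s≡0 (sym s′≡0))
          where
          s′≡0 : s′ ≡ 0#
          s′≡0 = x*x≡0⇒x≡0 (x*y≡0⇒y≡0 (norm≢0 v nv) (begin
            N * (s′ * s′) ≡⟨ *-comm N _ ⟩
            s′ * s′ * N   ≡⟨ eq ⟨
            s * s * N′    ≡⟨ cong (λ c → c * c * N′) s≡0 ⟩
            0# * 0# * N′  ≡⟨ cong (_* N′) (zeroˡ 0#) ⟩
            0# * N′       ≡⟨ zeroˡ N′ ⟩
            0#            ∎))
        ... | no s≢0 = x²≡y²⇒x≡±y (*-cancelˡ (norm≢0 v′ nv′) (begin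
            N′ * (s * s)   ≡⟨ *-comm N′ _ ⟩
            s * s * N′     ≡⟨ eq ⟩
            s′ * s′ * N    ≡⟨ cong (s′ * s′ *_) (norms-agree v v′ nv nv′ (r , r²≡NN′)) ⟩
            s′ * s′ * N′   ≡⟨ *-comm _ N′ ⟩
            N′ * (s′ * s′) ∎))
          where
          b = proj₁ (inverse s s≢0)
          sb≡1 = proj₂ (inverse s s≢0)
          -- r = s′ N / s, and r² = s′² N² / s² = N N′ by `eq`.
          r = s′ * N * b
          rearrange₁ : ∀ s′ N b → s′ * N * b * (s′ * N * b) ≡ s′ * s′ * N * N * b * b
          rearrange₁ = solve 3 (λ s′ N b →
            s′ :* N :* b :* (s′ :* N :* b) := s′ :* s′ :* N :* N :* b :* b) refl
          rearrange₂ : ∀ s N′ N b → s * s * N′ * N * b * b ≡ s * b * (s * b) * (N * N′)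
          rearrange₂ = solve 4 (λ s N′ N b →
            s :* s :* N′ :* N :* b :* b := s :* b :* (s :* b) :* (N :* N′)) refl
          r²≡NN′ : r * r ≡ N * N′
          r²≡NN′ = begin
            r * r                         ≡⟨ rearrange₁ s′ N b ⟩
            s′ * s′ * N * N * b * b       ≡⟨ cong (λ c → c * N * b * b) eq ⟨
            s * s * N′ * N * b * b        ≡⟨ rearrange₂ s N′ N b ⟩
            s * b * (s * b) * (N * N′)    ≡⟨ cong (λ c → c * c * (N * N′)) sb≡1 ⟩
            1# * 1# * (N * N′)            ≡⟨ cong (_* (N * N′)) (*-identityˡ 1#) ⟩
            1# * (N * N′)                 ≡⟨ *-identityˡ _ ⟩
            N * N′                        ∎

  module _ {γ : Carrier} {W : Pred Point 0ℓ} (half : IsHalfSystem γ W) where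
    open IsHalfSystem half

    half-no-opposite : ∀ {v v′} → W v → W v′ → v ≢ -ᵥ v′
    half-no-opposite {v} {v′} Wv Wv′ v≡-v′ with one-of-pair v′ (normed v′ Wv′)
    ... | inj₁ (_ , ¬W-v′) = ¬W-v′ (subst W v≡-v′ Wv)
    ... | inj₂ (¬Wv′ , _)  = ¬Wv′ Wv′

-- The characteristic is not 2.

module _ {q : ℕ} (𝔽 : FiniteField q) where
  open FiniteField 𝔽
  open FieldProperties 𝔽

  -- Otherwise e₁ = -e₁ would contradict the choice of one vector from {e₁, -e₁}.
  half⇒1≢-1 : ∀ {n} → let open Geometry 𝔽 (suc n) in
              ∀ {γ W} → IsHalfSystem γ W → 1# ≢ - 1#
  half⇒1≢-1 {n} {W = W} half 1≡-1 =
    refute (IsHalfSystem.one-of-pair half e₁ (inj₁ ‖e₁‖≡1))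
    where
    open Geometry 𝔽 (suc n)
    open Algebraic 𝔽 (suc n)
    e₁ : Point
    e₁ = 1# ∷ 0ᵥ
    ‖e₁‖≡1 : ‖ e₁ ‖ ≡ 1#
    ‖e₁‖≡1 = trans (cong₂ _+_ (*-identityˡ 1#) (0ᵥ-· {n} 0ᵥ)) (+-identityʳ 1#)
    0≡-0 : ∀ n → 0ᵥ {n} ≡ -ᵥ 0ᵥ
    0≡-0 zero    = refl
    0≡-0 (suc n) = cong₂ _∷_ (sym -0#≈0#) (0≡-0 n)
    e₁≡-e₁ : e₁ ≡ -ᵥ e₁
    e₁≡-e₁ = cong₂ _∷_ 1≡-1 (0≡-0 n)
    refute : ¬ ((W e₁ × ¬ W (-ᵥ e₁)) ⊎ (¬ W e₁ × W (-ᵥ e₁)))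
    refute (inj₁ (We₁ , ¬W-e₁)) = ¬W-e₁ (subst W e₁≡-e₁ We₁)
    refute (inj₂ (¬We₁ , W-e₁)) = ¬We₁ (subst W (sym e₁≡-e₁) W-e₁)

-- Deduplicated lists, and lists that enumerate the field and its vectors.

module _ {A : Set} {R T : A → A → Set} (R? : ∀ x y → Dec (R x y)) {P : A → Set}
  (T-refl : ∀ {x} → T x x) (T-trans : ∀ {x y z} → T x y → T y z → T x z)
  (R⇒T : ∀ {x y} → P x → P y → R x y → T x y) where

  -- The representative y of x may later be discarded in favour of an earlier z with `R z y`. The
  -- chain from z through y to x is composed in `T`, where transitivity is given; `R` enters only
  -- through `R⇒T`.
  deduplicate-covers : ∀ xs → (∀ {x} → x ∈ xs → P x) →
    ∀ {x} → x ∈ xs → ∃ λ y → y ∈ deduplicate R? xs × T y x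
  deduplicate-covers (z ∷ xs) Pxs (here refl) = z , here refl , T-refl
  deduplicate-covers (z ∷ xs) Pxs (there x∈xs)
    with deduplicate-covers xs (Pxs ∘ there) x∈xs
  ... | y , y∈ , Tyx with R? z y
  ... | yes Rzy = z , here refl ,
    T-trans (R⇒T (Pxs (here refl)) (Pxs (there (∈-deduplicate⁻ R? xs y∈))) Rzy) Tyx
  ... | no ¬Rzy = y , there (∈-filter⁺ (¬? ∘ R? z) y∈ ¬Rzy) , Tyx

length-cartesianProductWith : ∀ {A B C : Set} (f : A → B → C) xs ys →
  length (cartesianProductWith f xs ys) ≡ length xs ℕ.* length ys
length-cartesianProductWith f []       ys = refl
length-cartesianProductWith f (x ∷ xs) ys = trans (length-++ (map (f x) ys))
  (cong₂ ℕ._+_ (length-map (f x) ys) (length-cartesianProductWith f xs ys))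

length-vectors : ∀ {A : Set} (xs : List A) n → length (vectors xs n) ≡ length xs ℕ.^ n
length-vectors xs zero    = refl
length-vectors xs (suc n) = trans (length-cartesianProductWith _∷_ xs (vectors xs n))
  (cong (length xs ℕ.*_) (length-vectors xs n))

vectors-unique : ∀ {A : Set} {xs : List A} → Unique xs → ∀ n → Unique (vectors xs n)
vectors-unique uniq zero    = [] ∷ []
vectors-unique uniq (suc n) = Unique.cartesianProductWith⁺ _∷_
  (λ { refl → refl , refl }) uniq (vectors-unique uniq n)

module Enumerations {q : ℕ} (𝔽 : FiniteField q) where
  open FiniteField 𝔽
  open Sums

  elements-enumeration : IsEnumeration elements
  elements-enumeration = record
    { _≟_      = _≟_
    ; unique   = Unique.map⁺ (λ {i} {j} eq →
        trans (sym (Inverse.strictlyInverseˡ enumeration i))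
          (trans (cong (Inverse.to enumeration) eq)
            (Inverse.strictlyInverseˡ enumeration j))) (Unique.allFin⁺ q)
    ; complete = ∈-elements
    }

  length-elements : length elements ≡ q
  length-elements = trans (length-map (Inverse.from enumeration) (allFin q)) (length-tabulate _)

  points-enumeration : ∀ d → IsEnumeration (Geometry.points 𝔽 d)
  points-enumeration d = record
    { _≟_      = _≟ₚ_
    ; unique   = vectors-unique (IsEnumeration.unique elements-enumeration) d
    ; complete = ∈-points₀
    }
    where open Geometry 𝔽 d

  length-points : ∀ d → length (Geometry.points 𝔽 d) ≡ q ℕ.^ d
  length-points d = trans (length-vectors elements d) (cong (ℕ._^ d) length-elements)

-- Slices of E, Bessel's inequality and the second moment of the offset counts.

module Counting {q : ℕ} (𝔽 : FiniteField q) (d : ℕ) where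
  private module 𝔽 = FiniteField 𝔽
  open FiniteField 𝔽 using (Carrier; elements; 0#; 1#)
  open Geometry 𝔽 d
  open FieldProperties 𝔽 using (-‿+-comm; -‿involutive) renaming (+-comm to +ₖ-comm; +--ʳ+ to +ₖ--ʳ+; +-+ʳ- to +ₖ-+ʳ-; *-identityʳ to *ₖ-identityʳ)
  open Algebraic 𝔽 d using (·-+ˡ; ·-*ˡ; +ᵥ-−ᵥ; −ᵥ-+ᵥ)
  open Sums
  open Enumerations 𝔽
  open import Data.Integer hiding (_≟_)
  open import Data.Integer.Properties hiding (_≟_)
  open import Data.Integer.Tactic.RingSolver using (solve-∀)
  open ≡-Reasoning

  open IsEnumeration elements-enumeration
    using (_≟_) renaming (∑-δ to ∑-δₖ; ∑-bijection to ∑-bijectionₖ)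
  open IsEnumeration (points-enumeration d)
    using () renaming (∑-δ to ∑-δₚ; ∑-bijection to ∑-bijectionₚ)

  𝐪 𝐪ᵈ : ℤ
  𝐪  = + q
  𝐪ᵈ = + length points

  ∑-constₖ : ∀ c → ∑ elements (λ _ → c) ≡ c * 𝐪
  ∑-constₖ c = trans (∑-const elements c) (cong (λ n → c * + n) length-elements)

  ∑-translateₖ : ∀ a h → ∑ elements (λ c → h (a 𝔽.+ c)) ≡ ∑ elements h
  ∑-translateₖ a = ∑-bijectionₖ (a 𝔽.+_) (λ c → c 𝔽.+ (𝔽.- a))
    (λ c → trans (cong (𝔽._+ (𝔽.- a)) (+ₖ-comm a c)) (+ₖ-+ʳ- c a))
    (λ c → trans (+ₖ-comm a _) (+ₖ--ʳ+ c a))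

  reflect-involutive : ∀ t s → t 𝔽.+ (𝔽.- (t 𝔽.+ (𝔽.- s))) ≡ s
  reflect-involutive t s = begin
    t 𝔽.+ (𝔽.- (t 𝔽.+ (𝔽.- s)))         ≡⟨ cong (t 𝔽.+_) (-‿+-comm t (𝔽.- s)) ⟨
    t 𝔽.+ ((𝔽.- t) 𝔽.+ (𝔽.- (𝔽.- s)))   ≡⟨ cong (λ c → t 𝔽.+ ((𝔽.- t) 𝔽.+ c)) (-‿involutive s) ⟩
    t 𝔽.+ ((𝔽.- t) 𝔽.+ s)               ≡⟨ cong (t 𝔽.+_) (+ₖ-comm (𝔽.- t) s) ⟩
    t 𝔽.+ (s 𝔽.+ (𝔽.- t))               ≡⟨ +ₖ-comm t _ ⟩
    s 𝔽.+ (𝔽.- t) 𝔽.+ t                 ≡⟨ +ₖ--ʳ+ s t ⟩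
    s                                   ∎

  ∑-reflectₖ : ∀ t h → ∑ elements (λ s → h (t 𝔽.+ (𝔽.- s))) ≡ ∑ elements h
  ∑-reflectₖ t = ∑-bijectionₖ (λ s → t 𝔽.+ (𝔽.- s)) (λ s → t 𝔽.+ (𝔽.- s))
    (reflect-involutive t) (reflect-involutive t)

  -- Averaging over the translations along w, which move x · v through all of 𝔽
  -- and leave k fixed.
  ∑-fibres : ∀ {v w} → w · v ≡ 1# → ∀ h k → (∀ c x → k (x +ᵥ c *ᵥ w) ≡ k x) →
    𝐪 * ∑ points (λ x → h (x · v) * k x) ≡ ∑ elements h * ∑ points k
  ∑-fibres {v} {w} w·v≡1 h k k-inv = begin
    𝐪 * ∑ points (λ x → h (x · v) * k x)
      ≡⟨ trans (*-comm 𝐪 _) (sym (∑-constₖ _)) ⟩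
    ∑ elements (λ c → ∑ points (λ x → h (x · v) * k x))
      ≡⟨ ∑-cong elements (λ c → sym (∑-bijectionₚ (_+ᵥ c *ᵥ w) (_-ᵥ c *ᵥ w)
           (λ x → +ᵥ-−ᵥ x _) (λ x → −ᵥ-+ᵥ x _) (λ x → h (x · v) * k x))) ⟩
    ∑ elements (λ c → ∑ points (λ x → h ((x +ᵥ c *ᵥ w) · v) * k (x +ᵥ c *ᵥ w)))
      ≡⟨ ∑-cong elements (λ c → ∑-cong points (λ x →
           cong₂ _*_ (cong h (shift c x)) (k-inv c x))) ⟩
    ∑ elements (λ c → ∑ points (λ x → h (x · v 𝔽.+ c) * k x))
      ≡⟨ ∑-swap elements points _ ⟩
    ∑ points (λ x → ∑ elements (λ c → h (x · v 𝔽.+ c) * k x))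
      ≡⟨ ∑-cong points (λ x → trans (∑-*ʳ elements (k x) _)
           (cong (_* k x) (∑-translateₖ (x · v) h))) ⟩
    ∑ points (λ x → ∑ elements h * k x)
      ≡⟨ ∑-*ˡ points (∑ elements h) k ⟩
    ∑ elements h * ∑ points k ∎
    where
    shift : ∀ c x → (x +ᵥ c *ᵥ w) · v ≡ x · v 𝔽.+ c
    shift c x = trans (·-+ˡ x _ v) (cong (x · v 𝔽.+_)
      (trans (·-*ˡ c w v) (trans (cong (c 𝔽.*_) w·v≡1) (*ₖ-identityʳ c))))

  module _ {E : Pred Point 0ℓ} (E? : Decidable E) where

    e : Point → ℤ
    e x = 𝟙 (E? x)

    ∣E∣ : ℤ
    ∣E∣ = ∑ points e

    slice : Point → Carrier → ℤ
    slice v u = ∑ points (λ x → 𝟙 (u ≟ x · v) * e x)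

    -- The deviation of the slice from its mean, scaled by q to be an integer.
    dev : Point → Carrier → ℤ
    dev v u = 𝐪 * slice v u - ∣E∣

    energy : Point → ℤ
    energy v = ∑ elements (λ u → dev v u * dev v u)

    0≤energy : ∀ v → 0ℤ ≤ energy v
    0≤energy v = ∑-nonneg elements (λ u → 0≤i*i (dev v u))

    -- `slice v` is the pushforward of the indicator of E along x ↦ x · v.
    ∑-slice* : ∀ v (h : Carrier → ℤ) → ∑ elements (λ u → slice v u * h u) ≡ ∑ points (λ x → e x * h (x · v))
    ∑-slice* v h = begin
      ∑ elements (λ u → slice v u * h u)
        ≡⟨ ∑-cong elements (λ u → sym (∑-*ʳ points (h u) _)) ⟩
      ∑ elements (λ u → ∑ points (λ x → 𝟙 (u ≟ x · v) * e x * h u))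
        ≡⟨ ∑-swap elements points _ ⟩
      ∑ points (λ x → ∑ elements (λ u → 𝟙 (u ≟ x · v) * e x * h u))
        ≡⟨ ∑-cong points (λ x → trans
             (∑-cong elements (λ u → *-assoc (𝟙 (u ≟ x · v)) (e x) (h u)))
             (∑-δₖ (x · v) (λ u → e x * h u))) ⟩
      ∑ points (λ x → e x * h (x · v)) ∎

    ∑-slice : ∀ v → ∑ elements (slice v) ≡ ∣E∣
    ∑-slice v = begin
      ∑ elements (slice v)               ≡⟨ ∑-cong elements (λ u → sym (*-identityʳ (slice v u))) ⟩
      ∑ elements (λ u → slice v u * 1ℤ)  ≡⟨ ∑-slice* v (λ _ → 1ℤ) ⟩
      ∑ points (λ x → e x * 1ℤ)          ≡⟨ ∑-cong points (λ x → *-identityʳ (e x)) ⟩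
      ∣E∣                                ∎

    ∑-dev : ∀ v → ∑ elements (dev v) ≡ 0ℤ
    ∑-dev v = begin
      ∑ elements (dev v)                               ≡⟨ ∑-+ elements _ _ ⟩
      ∑ elements (λ u → 𝐪 * slice v u) + ∑ elements (λ _ → - ∣E∣)
        ≡⟨ cong₂ _+_ (trans (∑-*ˡ elements 𝐪 _) (cong (𝐪 *_) (∑-slice v))) (∑-constₖ _) ⟩
      𝐪 * ∣E∣ + - ∣E∣ * 𝐪                              ≡⟨ vanish 𝐪 ∣E∣ ⟩
      0ℤ                                               ∎
      where
      vanish : ∀ q e → q * e + - e * q ≡ 0ℤ
      vanish = solve-∀

    -- After pushing forward, `𝐪 * slice v u` splits as `dev v u + ∣E∣`, and the constant part
    -- contributes nothing because `dev v` sums to 0.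
    ∑-e*dev : ∀ v → 𝐪 * ∑ points (λ x → e x * dev v (x · v)) ≡ energy v
    ∑-e*dev v = begin
      𝐪 * ∑ points (λ x → e x * dev v (x · v))     ≡⟨ cong (𝐪 *_) (sym (∑-slice* v (dev v))) ⟩
      𝐪 * ∑ elements (λ u → slice v u * dev v u)   ≡⟨ sym (∑-*ˡ elements 𝐪 _) ⟩
      ∑ elements (λ u → 𝐪 * (slice v u * dev v u))
        ≡⟨ ∑-cong elements (λ u → expand 𝐪 (slice v u) ∣E∣) ⟩
      ∑ elements (λ u → dev v u * dev v u + ∣E∣ * dev v u)
        ≡⟨ ∑-+ elements _ _ ⟩
      energy v + ∑ elements (λ u → ∣E∣ * dev v u)
        ≡⟨ cong (_+_ (energy v)) (trans (∑-*ˡ elements ∣E∣ _)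
             (trans (cong (∣E∣ *_) (∑-dev v)) (*-zeroʳ ∣E∣))) ⟩
      energy v + 0ℤ                                ≡⟨ +-identityʳ _ ⟩
      energy v                                     ∎
      where
      expand : ∀ q s e → q * (s * (q * s - e)) ≡ (q * s - e) * (q * s - e) + e * (q * s - e)
      expand = solve-∀

    -- Every value of x · v is taken equally often. The multiplicity 𝐪ᵈ / 𝐪 is spread over the two
    -- sides to avoid a division.
    ∑-dev-diagonal : ∀ {v w} → w · v ≡ 1# →
      𝐪 * ∑ points (λ x → dev v (x · v) * dev v (x · v)) ≡ 𝐪ᵈ * energy v
    ∑-dev-diagonal {v} {w} w·v≡1 = begin
      𝐪 * ∑ points (λ x → dev v (x · v) * dev v (x · v))
        ≡⟨ cong (𝐪 *_) (∑-cong points (λ x → sym (*-identityʳ _))) ⟩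
      𝐪 * ∑ points (λ x → dev v (x · v) * dev v (x · v) * 1ℤ)
        ≡⟨ ∑-fibres {v} {w} w·v≡1 (λ u → dev v u * dev v u) (λ _ → 1ℤ) (λ _ _ → refl) ⟩
      energy v * ∑ points (λ _ → 1ℤ)      ≡⟨ cong (energy v *_) (∑-1 points) ⟩
      energy v * 𝐪ᵈ                       ≡⟨ *-comm (energy v) 𝐪ᵈ ⟩
      𝐪ᵈ * energy v                       ∎

    -- Translation along w fixes x · v′, so the second factor can play the role of k in `∑-fibres`,
    -- and the first sums to 0.
    ∑-dev-orthogonal : ∀ {v v′ w} → w · v ≡ 1# → w · v′ ≡ 0# →
      𝐪 * ∑ points (λ x → dev v (x · v) * dev v′ (x · v′)) ≡ 0ℤ
    ∑-dev-orthogonal {v} {v′} {w} w·v≡1 w·v′≡0 = trans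
      (∑-fibres {v} {w} w·v≡1 (dev v) (λ x → dev v′ (x · v′)) (λ c x → cong (dev v′) (fixed c x)))
      (cong (_* ∑ points (λ x → dev v′ (x · v′))) (∑-dev v))
      where
      fixed : ∀ c x → (x +ᵥ c *ᵥ w) · v′ ≡ x · v′
      fixed c x = trans (·-+ˡ x _ v′) (trans (cong (x · v′ 𝔽.+_)
        (trans (·-*ˡ c w v′) (trans (cong (c 𝔽.*_) w·v′≡0)
          (FieldProperties.zeroʳ 𝔽 c)))) (FieldProperties.+-identityʳ 𝔽 _))

    module Bessel {W : Pred Point 0ℓ} (W? : Decidable W)
      (dual : ∀ {v} → W v → ∃ λ w → w · v ≡ 1#)
      (separated : ∀ {v v′} → W v → W v′ → v ≢ v′ → ∃ λ w → w · v ≡ 1# × w · v′ ≡ 0#)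
      where

      ω : Point → ℤ
      ω v = 𝟙 (W? v)

      totalEnergy : ℤ
      totalEnergy = ∑ points (λ v → ω v * energy v)

      0≤totalEnergy : 0ℤ ≤ totalEnergy
      0≤totalEnergy = ∑-nonneg points (λ v → 0≤i*j (0≤𝟙 (W? v)) (0≤energy v))

      -- A sum without further coefficients suffices: by `∑-e*dev` and `∑-dev-diagonal`, the ratio
      -- of ⟨e, g⟩ to ⟨g, g⟩ for g(x) = `dev v (x · v)` is 1 / 𝐪ᵈ for every v in W of nonzero
      -- energy. So φ / 𝐪ᵈ is the orthogonal projection of `e` onto the span of these functions.
      φ : Point → ℤ
      φ x = ∑ points (λ v → ω v * dev v (x · v))

      inner : Point → Point → ℤ
      inner v v′ = ∑ points (λ x → dev v (x · v) * dev v′ (x · v′))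

      -- The Gram matrix is diagonal over W. The factors ω stay in place so that the vectors w are
      -- asked for only when v and v′ lie in W.
      𝐪*inner : ∀ v v′ → ω v * (ω v′ * (𝐪 * inner v v′)) ≡ 𝟙 (v′ ≟ₚ v) * (𝐪ᵈ * (ω v * energy v))
      𝐪*inner v v′ with v′ ≟ₚ v
      ... | yes refl = begin
        ω v * (ω v * (𝐪 * inner v v))   ≡⟨ 𝟙*-cong (W? v) (λ Wv → trans
                                             (cong (ω v *_) (∑-dev-diagonal {w = proj₁ (dual Wv)} (proj₂ (dual Wv))))
                                             (cong (_* (𝐪ᵈ * energy v)) (𝟙-yes (W? v) Wv))) ⟩
        ω v * (1ℤ * (𝐪ᵈ * energy v))    ≡⟨ rearrange (ω v) 𝐪ᵈ (energy v) ⟩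
        1ℤ * (𝐪ᵈ * (ω v * energy v))    ∎
        where
        rearrange : ∀ w n g → w * (1ℤ * (n * g)) ≡ 1ℤ * (n * (w * g))
        rearrange = solve-∀
      ... | no v′≢v = trans
        (𝟙*-cong (W? v) (λ Wv → trans
          (𝟙*-cong (W? v′) {j = 0ℤ} (λ Wv′ →
            let w , w·v≡1 , w·v′≡0 = separated Wv Wv′ (v′≢v ∘ sym) in
            ∑-dev-orthogonal {w = w} w·v≡1 w·v′≡0))
          (*-zeroʳ (ω v′))))
        (*-zeroʳ (ω v))

      ∑-φ² : 𝐪 * ∑ points (λ x → φ x * φ x) ≡ 𝐪ᵈ * totalEnergy
      ∑-φ² = begin
        𝐪 * ∑ points (λ x → φ x * φ x)
          ≡⟨ cong (𝐪 *_) (∑-cong points (λ x → ∑*∑ points points _ _)) ⟩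
        𝐪 * ∑ points (λ x → ∑ points (λ v → ∑ points (λ v′ → term x v v′)))
          ≡⟨ cong (𝐪 *_) (∑-swap points points _) ⟩
        𝐪 * ∑ points (λ v → ∑ points (λ x → ∑ points (λ v′ → term x v v′)))
          ≡⟨ ∑-*ˡ points 𝐪 _ ⟨
        ∑ points (λ v → 𝐪 * ∑ points (λ x → ∑ points (λ v′ → term x v v′)))
          ≡⟨ ∑-cong points (λ v → trans (cong (𝐪 *_) (∑-swap points points _))
               (sym (∑-*ˡ points 𝐪 _))) ⟩
        ∑ points (λ v → ∑ points (λ v′ → 𝐪 * ∑ points (λ x → term x v v′)))
          ≡⟨ ∑-cong points (λ v → ∑-cong points (λ v′ → trans (factor v v′) (𝐪*inner v v′))) ⟩
        ∑ points (λ v → ∑ points (λ v′ → 𝟙 (v′ ≟ₚ v) * (𝐪ᵈ * (ω v * energy v))))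
          ≡⟨ ∑-cong points (λ v → ∑-δₚ v (λ _ → 𝐪ᵈ * (ω v * energy v))) ⟩
        ∑ points (λ v → 𝐪ᵈ * (ω v * energy v))
          ≡⟨ ∑-*ˡ points 𝐪ᵈ _ ⟩
        𝐪ᵈ * totalEnergy ∎
        where
        term : Point → Point → Point → ℤ
        term x v v′ = (ω v * dev v (x · v)) * (ω v′ * dev v′ (x · v′))
        rearrange : ∀ a b c d → (a * b) * (c * d) ≡ (a * c) * (b * d)
        rearrange = solve-∀
        rearrange′ : ∀ q a b c → q * ((a * b) * c) ≡ a * (b * (q * c))
        rearrange′ = solve-∀
        factor : ∀ v v′ → 𝐪 * ∑ points (λ x → term x v v′) ≡ ω v * (ω v′ * (𝐪 * inner v v′))
        factor v v′ = trans (cong (𝐪 *_) (trans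
          (∑-cong points (λ x → rearrange (ω v) (dev v (x · v)) (ω v′) (dev v′ (x · v′))))
          (∑-*ˡ points (ω v * ω v′) _))) (rearrange′ 𝐪 (ω v) (ω v′) (inner v v′))

      ∑-e*φ : 𝐪 * ∑ points (λ x → e x * φ x) ≡ totalEnergy
      ∑-e*φ = begin
        𝐪 * ∑ points (λ x → e x * φ x)
          ≡⟨ cong (𝐪 *_) (∑-cong points (λ x → sym (∑-*ˡ points (e x) _))) ⟩
        𝐪 * ∑ points (λ x → ∑ points (λ v → e x * (ω v * dev v (x · v))))
          ≡⟨ cong (𝐪 *_) (∑-swap points points _) ⟩
        𝐪 * ∑ points (λ v → ∑ points (λ x → e x * (ω v * dev v (x · v))))
          ≡⟨ ∑-*ˡ points 𝐪 _ ⟨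
        ∑ points (λ v → 𝐪 * ∑ points (λ x → e x * (ω v * dev v (x · v))))
          ≡⟨ ∑-cong points (λ v → begin
               𝐪 * ∑ points (λ x → e x * (ω v * dev v (x · v)))
                 ≡⟨ cong (𝐪 *_) (∑-cong points (λ x → swap (e x) (ω v) (dev v (x · v)))) ⟩
               𝐪 * ∑ points (λ x → ω v * (e x * dev v (x · v)))
                 ≡⟨ cong (𝐪 *_) (∑-*ˡ points (ω v) _) ⟩
               𝐪 * (ω v * ∑ points (λ x → e x * dev v (x · v)))
                 ≡⟨ swap 𝐪 (ω v) _ ⟩
               ω v * (𝐪 * ∑ points (λ x → e x * dev v (x · v)))
                 ≡⟨ cong (ω v *_) (∑-e*dev v) ⟩
               ω v * energy v ∎) ⟩
        totalEnergy ∎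
        where
        swap : ∀ a b c → a * (b * c) ≡ b * (a * c)
        swap = solve-∀

      -- Write S for `totalEnergy`. Cauchy-Schwarz with weight `e` gives ⟨e, φ⟩² ≤ ∣E∣ ⟨φ, φ⟩.
      -- Multiplied by 𝐪² this becomes S² ≤ 𝐪 ∣E∣ 𝐪ᵈ S, by `∑-e*φ` and `∑-φ²`, and S cancels unless
      -- it is 0.
      bessel : totalEnergy ≤ 𝐪 * ∣E∣ * 𝐪ᵈ
      bessel = cancel (totalEnergy ≟ᶻ 0ℤ)
        where
        open import Data.Integer.Properties using () renaming (_≟_ to _≟ᶻ_)
        T = ∑ points (λ x → e x * φ x)
        Φ = ∑ points (λ x → φ x * φ x)
        0≤∣E∣ : 0ℤ ≤ ∣E∣
        0≤∣E∣ = ∑-nonneg points (λ x → 0≤𝟙 (E? x))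
        T²≤ : T * T ≤ ∣E∣ * Φ
        T²≤ = ≤-trans (cauchy-schwarz e (λ x → 0≤𝟙 (E? x)) φ points)
          (*-monoˡ-≤ 0≤∣E∣ (∑-mono points (λ x → ≤-trans
            (*-monoʳ-≤ (0≤i*i (φ x)) (𝟙≤1 (E? x))) (≤-reflexive (*-identityˡ _)))))
        square : totalEnergy * totalEnergy ≤ 𝐪 * ∣E∣ * 𝐪ᵈ * totalEnergy
        square = subst₂ _≤_
          (trans (rearrange₁ 𝐪 T) (cong₂ _*_ ∑-e*φ ∑-e*φ))
          (trans (rearrange₂ 𝐪 ∣E∣ Φ) (trans (cong (𝐪 * ∣E∣ *_) ∑-φ²) (sym (*-assoc (𝐪 * ∣E∣) 𝐪ᵈ _))))
          (*-monoˡ-≤ {𝐪 * 𝐪} (0≤i*i 𝐪) T²≤)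
          where
          rearrange₁ : ∀ q t → q * q * (t * t) ≡ (q * t) * (q * t)
          rearrange₁ = solve-∀
          rearrange₂ : ∀ q e f → q * q * (e * f) ≡ q * e * (q * f)
          rearrange₂ = solve-∀
        cancel : Dec (totalEnergy ≡ 0ℤ) → totalEnergy ≤ 𝐪 * ∣E∣ * 𝐪ᵈ
        cancel (yes S≡0) = subst (_≤ 𝐪 * ∣E∣ * 𝐪ᵈ) (sym S≡0)
          (0≤i*j (0≤i*j {𝐪} (+≤+ z≤n) 0≤∣E∣) (+≤+ z≤n))
        cancel (no S≢0) = *-cancelʳ-≤-pos _ _ totalEnergy
          {{positive (≤∧≢⇒< 0≤totalEnergy (S≢0 ∘ sym))}} square

      module Offsets {F : Pred Params 0ℓ} (F? : Decidable F) where

        f : Params → ℤ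
        f p = 𝟙 (F? p)

        ∣F∣ : ℤ
        ∣F∣ = ∑ params f

        -- The number of (x , v , t) ∈ E × F with t - x · v ≡ s.
        count : Carrier → ℤ
        count s = ∑ params (λ (v , t) → f (v , t) * slice v (t 𝔽.+ (𝔽.- s)))

        ∑-count : ∑ elements count ≡ ∣F∣ * ∣E∣
        ∑-count = begin
          ∑ elements count
            ≡⟨ ∑-swap elements params _ ⟩
          ∑ params (λ (v , t) → ∑ elements (λ s → f (v , t) * slice v (t 𝔽.+ (𝔽.- s))))
            ≡⟨ ∑-cong params (λ (v , t) → trans (∑-*ˡ elements (f (v , t)) _)
                 (cong (f (v , t) *_) (trans (∑-reflectₖ t (slice v)) (∑-slice v)))) ⟩
          ∑ params (λ p → f p * ∣E∣)   ≡⟨ ∑-*ʳ params ∣E∣ f ⟩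
          ∣F∣ * ∣E∣                     ∎

        countDev : Carrier → ℤ
        countDev s = ∑ params (λ (v , t) → f (v , t) * dev v (t 𝔽.+ (𝔽.- s)))

        countDev-count : ∀ s → countDev s ≡ 𝐪 * count s - ∣F∣ * ∣E∣
        countDev-count s = begin
          countDev s
            ≡⟨ ∑-cong params (λ (v , t) → expand (f (v , t)) 𝐪 (slice v (t 𝔽.+ (𝔽.- s))) ∣E∣) ⟩
          ∑ params (λ (v , t) → 𝐪 * (f (v , t) * slice v (t 𝔽.+ (𝔽.- s))) + f (v , t) * (- ∣E∣))
            ≡⟨ ∑-+ params _ _ ⟩
          ∑ params (λ (v , t) → 𝐪 * (f (v , t) * slice v (t 𝔽.+ (𝔽.- s)))) + ∑ params (λ p → f p * (- ∣E∣))
            ≡⟨ cong₂ _+_ (∑-*ˡ params 𝐪 _) (∑-*ʳ params (- ∣E∣) f) ⟩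
          𝐪 * count s + ∣F∣ * (- ∣E∣)
            ≡⟨ cong (_+_ (𝐪 * count s)) (sym (neg-distribʳ-* ∣F∣ ∣E∣)) ⟩
          𝐪 * count s - ∣F∣ * ∣E∣ ∎
          where
          expand : ∀ f q s e → f * (q * s - e) ≡ q * (f * s) + f * (- e)
          expand = solve-∀

        ∑-count² : ℤ
        ∑-count² = ∑ elements (λ s → count s * count s)

        -- The variance identity, with m = ∣F∣ ∣E∣ the total count: the cross term contributes
        -- -2𝐪m², and the 𝐪 copies of m² bring this to -𝐪m².
        ∑-countDev² : ∑ elements (λ s → countDev s * countDev s)
          ≡ 𝐪 * (𝐪 * ∑-count² - (∣F∣ * ∣E∣) * (∣F∣ * ∣E∣))
        ∑-countDev² = begin
          ∑ elements (λ s → countDev s * countDev s)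
            ≡⟨ ∑-cong elements (λ s → trans (cong₂ _*_ (countDev-count s) (countDev-count s))
                 (expand 𝐪 (count s) m)) ⟩
          ∑ elements (λ s → 𝐪 * 𝐪 * (count s * count s) + (- (+ 2 * 𝐪 * m) * count s + m * m))
            ≡⟨ ∑-+ elements _ _ ⟩
          ∑ elements (λ s → 𝐪 * 𝐪 * (count s * count s)) + ∑ elements (λ s → - (+ 2 * 𝐪 * m) * count s + m * m)
            ≡⟨ cong₂ _+_ (∑-*ˡ elements (𝐪 * 𝐪) _) (trans (∑-+ elements _ _)
                 (cong₂ _+_ (trans (∑-*ˡ elements (- (+ 2 * 𝐪 * m)) count) (cong (- (+ 2 * 𝐪 * m) *_) ∑-count))
                            (∑-constₖ (m * m)))) ⟩
          𝐪 * 𝐪 * ∑-count² + (- (+ 2 * 𝐪 * m) * m + m * m * 𝐪)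
            ≡⟨ collect 𝐪 ∑-count² m ⟩
          𝐪 * (𝐪 * ∑-count² - m * m) ∎
          where
          m = ∣F∣ * ∣E∣
          expand : ∀ q c m → (q * c - m) * (q * c - m) ≡ q * q * (c * c) + (- (+ 2 * q * m) * c + m * m)
          expand = solve-∀
          collect : ∀ q n m → q * q * n + (- (+ 2 * q * m) * m + m * m * q) ≡ q * (q * n - m * m)
          collect = solve-∀

        0≤∣F∣ : 0ℤ ≤ ∣F∣
        0≤∣F∣ = ∑-nonneg params (λ p → 0≤𝟙 (F? p))

        module _ {M : ℤ} (fibre≤ : ∀ v → ∑ elements (λ t → f (v , t)) ≤ ω v * M) (0≤M : 0ℤ ≤ M) where

          -- Cauchy-Schwarz over F is applied for each s before summing over s. For fixed (v, t) the
          -- argument t - s then runs through the whole field, so t drops out and `energy v`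
          -- remains, once for each t in the fibre over v.
          ∑-countDev²≤ : ∑ elements (λ s → countDev s * countDev s) ≤ ∣F∣ * (M * totalEnergy)
          ∑-countDev²≤ = ≤-trans
            (∑-mono elements (λ s → cauchy-schwarz f (λ p → 0≤𝟙 (F? p)) _ params))
            (≤-trans (≤-reflexive regroup) (*-monoˡ-≤ 0≤∣F∣ (≤-trans
              (∑-mono points (λ v → *-monoʳ-≤ (0≤energy v) (fibre≤ v)))
              (≤-reflexive (trans (∑-cong points (λ v → swap (ω v) M (energy v))) (∑-*ˡ points M _))))))
            where
            swap : ∀ a b c → a * b * c ≡ b * (a * c)
            swap = solve-∀
            regroup : ∑ elements (λ s → ∣F∣ * ∑ params (λ (v , t) →
                f (v , t) * (dev v (t 𝔽.+ (𝔽.- s)) * dev v (t 𝔽.+ (𝔽.- s)))))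
              ≡ ∣F∣ * ∑ points (λ v → ∑ elements (λ t → f (v , t)) * energy v)
            regroup = trans (∑-*ˡ elements ∣F∣ _) (cong (∣F∣ *_) (begin
              ∑ elements (λ s → ∑ params (λ (v , t) →
                f (v , t) * (dev v (t 𝔽.+ (𝔽.- s)) * dev v (t 𝔽.+ (𝔽.- s)))))
                ≡⟨ ∑-swap elements params _ ⟩
              ∑ params (λ (v , t) → ∑ elements (λ s →
                f (v , t) * (dev v (t 𝔽.+ (𝔽.- s)) * dev v (t 𝔽.+ (𝔽.- s)))))
                ≡⟨ ∑-cong params (λ (v , t) → trans (∑-*ˡ elements (f (v , t)) _)
                     (cong (f (v , t) *_) (∑-reflectₖ t (λ u → dev v u * dev v u)))) ⟩
              ∑ params (λ (v , t) → f (v , t) * energy v)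
                ≡⟨ ∑-cartesianProduct points elements _ ⟩
              ∑ points (λ v → ∑ elements (λ t → f (v , t) * energy v))
                ≡⟨ ∑-cong points (λ v → ∑-*ʳ elements (energy v) _) ⟩
              ∑ points (λ v → ∑ elements (λ t → f (v , t)) * energy v) ∎))

          -- `∑-countDev²` and `bessel` each carry a factor 𝐪 left by the scaling of `dev`; it is
          -- cancelled here.
          ∑-count²≤ : 𝐪 * ∑-count² ≤ (∣F∣ * ∣E∣) * (∣F∣ * ∣E∣) + ∣F∣ * M * ∣E∣ * 𝐪ᵈ
          ∑-count²≤ = subst (_≤ m * m + ∣F∣ * M * ∣E∣ * 𝐪ᵈ) (restore _ (m * m))
            (+-monoʳ-≤ (m * m) (*-cancelˡ-≤-pos _ _ 𝐪
              {{positive (+<+ (ℕ.>-nonZero⁻¹ q {{FiniteField.q-nonZero 𝔽}}))}} scaled))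
            where
            m = ∣F∣ * ∣E∣
            restore : ∀ a b → b + (a - b) ≡ a
            restore = solve-∀
            rearrange : ∀ q f M e n → f * (M * (q * e * n)) ≡ q * (f * M * e * n)
            rearrange = solve-∀
            scaled : 𝐪 * (𝐪 * ∑-count² - m * m) ≤ 𝐪 * (∣F∣ * M * ∣E∣ * 𝐪ᵈ)
            scaled = subst₂ _≤_ ∑-countDev² (rearrange 𝐪 ∣F∣ M ∣E∣ 𝐪ᵈ)
              (≤-trans ∑-countDev²≤ (*-monoˡ-≤ 0≤∣F∣ (*-monoˡ-≤ 0≤M bessel)))

        module _ (L : List Carrier)
          (L-covers : ∀ {x v t} → E x → F (v , t) → t 𝔽.+ (𝔽.- (x · v)) ∈ L) where

          ∈L? : ∀ s → Dec (s ∈ L)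
          ∈L? s = Any.any? (s ≟_) L

          -- Only an inequality, since L may repeat values: the offset 0, for instance, equals its
          -- negative.
          ∑-∈L : ∑ elements (λ s → 𝟙 (∈L? s)) ≤ + length L
          ∑-∈L = bound L
            where
            bound : ∀ ys → ∑ elements (λ s → 𝟙 (Any.any? (s ≟_) ys)) ≤ + length ys
            bound []       = ≤-reflexive (∑-0 elements)
            bound (y ∷ ys) = ≤-trans (∑-mono elements split) (≤-trans
              (≤-reflexive (∑-+ elements _ _)) (+-mono-≤ (≤-reflexive (trans
                (∑-cong elements (λ s → sym (*-identityʳ (𝟙 (s ≟ y))))) (∑-δₖ y (λ _ → 1ℤ)))) (bound ys)))
              where
              split : ∀ s → 𝟙 (Any.any? (s ≟_) (y ∷ ys)) ≤ 𝟙 (s ≟ y) + 𝟙 (Any.any? (s ≟_) ys)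
              split s = 𝟙-⊎ (Any.any? (s ≟_) (y ∷ ys)) (s ≟ y) (Any.any? (s ≟_) ys)
                (λ { (here s≡y) → inj₁ s≡y ; (there s∈ys) → inj₂ s∈ys })

          count-supported : ∀ s → count s ≡ 𝟙 (∈L? s) * count s
          count-supported s with ∈L? s
          ... | yes s∈L = sym (*-identityˡ _)
          ... | no  s∉L = trans (∑-cong params (λ (v , t) → trans
              (𝟙*-cong (F? (v , t)) {j = 0ℤ} (λ Fvt → trans
                (∑-cong points (λ x → trans (*-comm (𝟙 (t 𝔽.+ (𝔽.- s) ≟ x · v)) (e x))
                  (trans (𝟙*-cong (E? x) {j = 0ℤ} (λ Ex →
                    𝟙-no (t 𝔽.+ (𝔽.- s) ≟ x · v) (λ t-s≡x·v → s∉L (subst (_∈ L)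
                      (trans (cong (λ c → t 𝔽.+ (𝔽.- c)) (sym t-s≡x·v)) (reflect-involutive t s))
                      (L-covers Ex Fvt)))))
                    (*-zeroʳ (e x)))))
                (∑-0 points)))
              (*-zeroʳ (f (v , t))))) (∑-0 params)

          -- Weighting Cauchy-Schwarz by the indicator of L replaces 𝐪 by the length of L, and by
          -- `count-supported` the total count is unaffected.
          ∣F∣∣E∣²≤ : (∣F∣ * ∣E∣) * (∣F∣ * ∣E∣) ≤ + length L * ∑-count²
          ∣F∣∣E∣²≤ = subst (λ m → m * m ≤ + length L * ∑-count²)
            (trans (sym (∑-cong elements count-supported)) ∑-count)
            (≤-trans (cauchy-schwarz (λ s → 𝟙 (∈L? s)) (λ s → 0≤𝟙 (∈L? s)) count elements)
            (≤-trans (*-monoʳ-≤ (∑-nonneg elements (λ s → 0≤i*j (0≤𝟙 (∈L? s)) (0≤i*i (count s)))) ∑-∈L)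
            (*-monoˡ-≤ {+ length L} (+≤+ z≤n) (∑-mono elements (λ s → ≤-trans
              (*-monoʳ-≤ (0≤i*i (count s)) (𝟙≤1 (∈L? s))) (≤-reflexive (*-identityˡ _)))))))

-- Passage from natural numbers to rationals.

module FromℕProperties where

  open import Data.Nat using (_≤_; _<_)
  open import Data.Integer as ℤ using (+_)
  import Data.Integer.Properties as ℤ
  open import Data.Nat.Tactic.RingSolver using (solve-∀)
  import Data.Rational.Properties as ℚ
  open import Data.Rational.Unnormalised as ℚᵘ using (mkℚᵘ; *≡*; *≤*; *<*)
  import Data.Rational.Unnormalised.Properties as ℚᵘ

  toℚᵘ-fromℕ : ∀ n → ℚ.toℚᵘ (fromℕ n) ℚᵘ.≃ mkℚᵘ (+ n) 0
  toℚᵘ-fromℕ n = ℚ.toℚᵘ-fromℚᵘ (mkℚᵘ (+ n) 0)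

  fromℕ-+ : ∀ m n → fromℕ (m ℕ.+ n) ≡ fromℕ m ℚ.+ fromℕ n
  fromℕ-+ m n = ℚ.toℚᵘ-injective (begin
    ℚ.toℚᵘ (fromℕ (m ℕ.+ n))                     ≈⟨ toℚᵘ-fromℕ (m ℕ.+ n) ⟩
    mkℚᵘ (+ (m ℕ.+ n)) 0                         ≈⟨ *≡* (cong (ℤ._* + 1)
                                                     (sym (cong₂ ℤ._+_ (ℤ.*-identityʳ (+ m)) (ℤ.*-identityʳ (+ n))))) ⟩
    mkℚᵘ (+ m) 0 ℚᵘ.+ mkℚᵘ (+ n) 0               ≈⟨ ℚᵘ.+-cong (toℚᵘ-fromℕ m) (toℚᵘ-fromℕ n) ⟨
    ℚ.toℚᵘ (fromℕ m) ℚᵘ.+ ℚ.toℚᵘ (fromℕ n)       ≈⟨ ℚ.toℚᵘ-homo-+ (fromℕ m) (fromℕ n) ⟨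
    ℚ.toℚᵘ (fromℕ m ℚ.+ fromℕ n)                 ∎)
    where open import Relation.Binary.Reasoning.Setoid ℚᵘ.≃-setoid

  fromℕ-* : ∀ m n → fromℕ (m ℕ.* n) ≡ fromℕ m ℚ.* fromℕ n
  fromℕ-* m n = ℚ.toℚᵘ-injective (begin
    ℚ.toℚᵘ (fromℕ (m ℕ.* n))                     ≈⟨ toℚᵘ-fromℕ (m ℕ.* n) ⟩
    mkℚᵘ (+ (m ℕ.* n)) 0                         ≈⟨ *≡* (cong (ℤ._* + 1) (ℤ.pos-* m n)) ⟩
    mkℚᵘ (+ m) 0 ℚᵘ.* mkℚᵘ (+ n) 0               ≈⟨ ℚᵘ.*-cong (toℚᵘ-fromℕ m) (toℚᵘ-fromℕ n) ⟨
    ℚ.toℚᵘ (fromℕ m) ℚᵘ.* ℚ.toℚᵘ (fromℕ n)       ≈⟨ ℚ.toℚᵘ-homo-* (fromℕ m) (fromℕ n) ⟨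
    ℚ.toℚᵘ (fromℕ m ℚ.* fromℕ n)                 ∎)
    where open import Relation.Binary.Reasoning.Setoid ℚᵘ.≃-setoid

  fromℕ-mono-≤ : ∀ {m n} → m ≤ n → fromℕ m ℚ.≤ fromℕ n
  fromℕ-mono-≤ {m} {n} m≤n = ℚ.toℚᵘ-cancel-≤
    (ℚᵘ.≤-respʳ-≃ (ℚᵘ.≃-sym (toℚᵘ-fromℕ n)) (ℚᵘ.≤-respˡ-≃ (ℚᵘ.≃-sym (toℚᵘ-fromℕ m))
      (*≤* (ℤ.*-monoʳ-≤-nonNeg (+ 1) (ℤ.+≤+ m≤n)))))

  fromℕ-*-inverse : ∀ q .{{_ : ℕ.NonZero q}} → fromℕ q ℚ.* (+ 1 ℚ./ q) ≡ ℚ.1ℚ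
  fromℕ-*-inverse (suc n) = ℚ.toℚᵘ-injective (begin
    ℚ.toℚᵘ (fromℕ (suc n) ℚ.* (+ 1 ℚ./ suc n))           ≈⟨ ℚ.toℚᵘ-homo-* (fromℕ (suc n)) _ ⟩
    ℚ.toℚᵘ (fromℕ (suc n)) ℚᵘ.* ℚ.toℚᵘ (+ 1 ℚ./ suc n)   ≈⟨ ℚᵘ.*-cong (toℚᵘ-fromℕ (suc n)) (ℚ.toℚᵘ-fromℚᵘ (mkℚᵘ (+ 1) n)) ⟩
    mkℚᵘ (+ suc n) 0 ℚᵘ.* mkℚᵘ (+ 1) n                   ≈⟨ ℚᵘ.*-inverseʳ (mkℚᵘ (+ suc n) 0) ⟩
    ℚ.toℚᵘ ℚ.1ℚ                                          ∎)
    where open import Relation.Binary.Reasoning.Setoid ℚᵘ.≃-setoid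

  /-< : ∀ {m k} d .{{_ : ℕ.NonZero d}} → m < k ℕ.* d → + m ℚ./ d ℚ.< fromℕ k
  /-< {m} {k} (suc n) m<kd = ℚ.toℚᵘ-cancel-<
    (ℚᵘ.<-respʳ-≃ (ℚᵘ.≃-sym (toℚᵘ-fromℕ k))
      (ℚᵘ.<-respˡ-≃ (ℚᵘ.≃-sym (ℚ.toℚᵘ-fromℚᵘ (mkℚᵘ (+ m) n)))
        (*<* (subst₂ ℤ._<_ (sym (ℤ.*-identityʳ (+ m))) (ℤ.pos-* k (suc n)) (ℤ.+<+ m<kd)))))

  p≤r*D⇒p÷D≤r : ∀ {p r} D .{{_ : ℚ.NonZero D}} → ℚ.0ℚ ℚ.≤ D →
                p ℚ.≤ r ℚ.* D → p ℚ.÷ D ℚ.≤ r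
  p≤r*D⇒p÷D≤r {p} {r} D 0≤D p≤rD =
    ℚ.*-cancelʳ-≤-pos D {{ℚ.nonNeg∧nonZero⇒pos D {{ℚ.nonNegative 0≤D}}}} (begin
      p ℚ.* ℚ.1/ D ℚ.* D      ≡⟨ ℚ.*-assoc p (ℚ.1/ D) D ⟩
      p ℚ.* (ℚ.1/ D ℚ.* D)    ≡⟨ cong (p ℚ.*_) (ℚ.*-inverseˡ D) ⟩
      p ℚ.* ℚ.1ℚ              ≡⟨ ℚ.*-identityʳ p ⟩
      p                       ≤⟨ p≤rD ⟩
      r ℚ.* D                 ∎)
    where open ℚ.≤-Reasoning

  -- Multiplication by q clears the fraction: q D is the natural number 2X + qZ. Both 0 ≤ D and the
  -- main comparison are proved after this multiplication.
  ÷-≤ : ∀ q .{{_ : ℕ.NonZero q}} k X Z → q ℕ.* X ≤ k ℕ.* (2 ℕ.* X ℕ.+ q ℕ.* Z) →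
    let D = fromℕ 2 ℚ.* (+ 1 ℚ./ q) ℚ.* fromℕ X ℚ.+ fromℕ Z in
    .{{_ : ℚ.NonZero D}} → fromℕ X ℚ.÷ D ℚ.≤ fromℕ k
  ÷-≤ q k X Z qX≤ = p≤r*D⇒p÷D≤r D 0≤D X≤kD
    where
    open ℚ.≤-Reasoning
    q⁻¹ = + 1 ℚ./ q
    D = fromℕ 2 ℚ.* q⁻¹ ℚ.* fromℕ X ℚ.+ fromℕ Z
    instance
      q-pos : ℚ.Positive (fromℕ q)
      q-pos = ℚ.normalize-pos q 1
    qD≡ : fromℕ q ℚ.* D ≡ fromℕ (2 ℕ.* X ℕ.+ q ℕ.* Z)
    qD≡ = begin-equality
      fromℕ q ℚ.* D
        ≡⟨ ℚ.*-distribˡ-+ (fromℕ q) (fromℕ 2 ℚ.* q⁻¹ ℚ.* fromℕ X) (fromℕ Z) ⟩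
      fromℕ q ℚ.* (fromℕ 2 ℚ.* q⁻¹ ℚ.* fromℕ X) ℚ.+ fromℕ q ℚ.* fromℕ Z
        ≡⟨ cong₂ ℚ._+_ cancel (sym (fromℕ-* q Z)) ⟩
      fromℕ (2 ℕ.* X) ℚ.+ fromℕ (q ℕ.* Z)
        ≡⟨ fromℕ-+ (2 ℕ.* X) (q ℕ.* Z) ⟨
      fromℕ (2 ℕ.* X ℕ.+ q ℕ.* Z) ∎
      where
      cancel : fromℕ q ℚ.* (fromℕ 2 ℚ.* q⁻¹ ℚ.* fromℕ X) ≡ fromℕ (2 ℕ.* X)
      cancel = begin-equality
        fromℕ q ℚ.* (fromℕ 2 ℚ.* q⁻¹ ℚ.* fromℕ X)
          ≡⟨ cong (λ r → fromℕ q ℚ.* (r ℚ.* fromℕ X)) (ℚ.*-comm (fromℕ 2) q⁻¹) ⟩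
        fromℕ q ℚ.* (q⁻¹ ℚ.* fromℕ 2 ℚ.* fromℕ X)
          ≡⟨ cong (fromℕ q ℚ.*_) (ℚ.*-assoc q⁻¹ (fromℕ 2) (fromℕ X)) ⟩
        fromℕ q ℚ.* (q⁻¹ ℚ.* (fromℕ 2 ℚ.* fromℕ X))
          ≡⟨ ℚ.*-assoc (fromℕ q) q⁻¹ _ ⟨
        fromℕ q ℚ.* q⁻¹ ℚ.* (fromℕ 2 ℚ.* fromℕ X)
          ≡⟨ cong₂ ℚ._*_ (fromℕ-*-inverse q) (sym (fromℕ-* 2 X)) ⟩
        ℚ.1ℚ ℚ.* fromℕ (2 ℕ.* X)
          ≡⟨ ℚ.*-identityˡ _ ⟩
        fromℕ (2 ℕ.* X) ∎
    0≤D : ℚ.0ℚ ℚ.≤ D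
    0≤D = ℚ.*-cancelˡ-≤-pos (fromℕ q) (begin
      fromℕ q ℚ.* ℚ.0ℚ                  ≡⟨ ℚ.*-zeroʳ (fromℕ q) ⟩
      fromℕ 0                           ≤⟨ fromℕ-mono-≤ {0} {2 ℕ.* X ℕ.+ q ℕ.* Z} z≤n ⟩
      fromℕ (2 ℕ.* X ℕ.+ q ℕ.* Z)       ≡⟨ qD≡ ⟨
      fromℕ q ℚ.* D                     ∎)
    X≤kD : fromℕ X ℚ.≤ fromℕ k ℚ.* D
    X≤kD = ℚ.*-cancelˡ-≤-pos (fromℕ q) (begin
      fromℕ q ℚ.* fromℕ X                            ≡⟨ fromℕ-* q X ⟨
      fromℕ (q ℕ.* X)                                ≤⟨ fromℕ-mono-≤ qX≤ ⟩
      fromℕ (k ℕ.* (2 ℕ.* X ℕ.+ q ℕ.* Z))            ≡⟨ fromℕ-* k _ ⟩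
      fromℕ k ℚ.* fromℕ (2 ℕ.* X ℕ.+ q ℕ.* Z)        ≡⟨ cong (fromℕ k ℚ.*_) qD≡ ⟨
      fromℕ k ℚ.* (fromℕ q ℚ.* D)                    ≡⟨ ℚ.*-assoc (fromℕ k) (fromℕ q) D ⟨
      fromℕ k ℚ.* fromℕ q ℚ.* D                      ≡⟨ cong (ℚ._* D) (ℚ.*-comm (fromℕ k) (fromℕ q)) ⟩
      fromℕ q ℚ.* fromℕ k ℚ.* D                      ≡⟨ ℚ.*-assoc (fromℕ q) (fromℕ k) D ⟩
      fromℕ q ℚ.* (fromℕ k ℚ.* D)                    ∎)

  -- From q X ≤ 2k (X + Y) < 4k X, cancel X. The 4 is the 2 already in the bound times the 2 gained
  -- from Y < X.
  <-of-dominated : ∀ {q k X Y} → 0 < q → Y < X →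
                   q ℕ.* X ≤ 2 ℕ.* k ℕ.* (X ℕ.+ Y) → q < k ℕ.* 4
  -- For k = 0 the strict step below fails, but then the positive q X would be at most 0.
  <-of-dominated {suc q} {zero}  {suc X} 0<q Y<X ()
  <-of-dominated {q}     {suc k} {X} {Y} 0<q Y<X qX≤ = ℕ.*-cancelʳ-< X q (suc k ℕ.* 4) (begin-strict
    q ℕ.* X                            ≤⟨ qX≤ ⟩
    2 ℕ.* suc k ℕ.* (X ℕ.+ Y)          <⟨ ℕ.*-monoʳ-< (2 ℕ.* suc k) (ℕ.+-monoʳ-< X Y<X) ⟩
    2 ℕ.* suc k ℕ.* (X ℕ.+ X)          ≡⟨ double (suc k) X ⟩
    suc k ℕ.* 4 ℕ.* X                  ∎)
    where
    open ℕ.≤-Reasoning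
    double : ∀ k X → 2 ℕ.* k ℕ.* (X ℕ.+ X) ≡ k ℕ.* 4 ℕ.* X
    double = solve-∀

-- From equivalence classes to offsets, and the resulting inequality in ℕ.

module _ {A : Set} (f : A → A) where

  -- Used with f the negation of the field; the doubled length is the origin of both factors 2 in
  -- the denominator of the theorem.
  pairs : List A → List A
  pairs []       = []
  pairs (x ∷ xs) = x ∷ f x ∷ pairs xs

  length-pairs : ∀ xs → length (pairs xs) ≡ 2 ℕ.* length xs
  length-pairs []       = refl
  length-pairs (x ∷ xs) = trans (cong (suc ∘ suc) (length-pairs xs))
    (sym (ℕ.*-suc 2 (length xs)))

  ∈-pairs₁ : ∀ {x xs} → x ∈ xs → x ∈ pairs xs
  ∈-pairs₁ (here refl)  = here refl
  ∈-pairs₁ (there x∈xs) = there (there (∈-pairs₁ x∈xs))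

  ∈-pairs₂ : ∀ {x xs} → x ∈ xs → f x ∈ pairs xs
  ∈-pairs₂ (here refl)  = there (here refl)
  ∈-pairs₂ (there x∈xs) = there (there (∈-pairs₂ x∈xs))

module Incidence {q : ℕ} (𝔽 : FiniteField q) (d′ : ℕ) where
  open FiniteField 𝔽 using (Carrier; elements; 0#; 1#; -_; IsSquare)
  private
    d = suc d′
  open Geometry 𝔽 d
  open Algebraic 𝔽 d
  open Sums
  open Enumerations 𝔽
  open Counting 𝔽 d using (module Bessel; ∣E∣)
  open import Data.Integer as ℤ using (+_)
  import Data.Integer.Properties as ℤ
  open import Data.Nat using (_≤_; _<_)
  open Data.List.Extrema ℕ.≤-totalOrder using (xs≤max; max≤v⁺)

  module _ {γ : Carrier} (γ≢0 : γ ≢ 0#) (¬□γ : ¬ IsSquare γ)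
    {W : Pred Point 0ℓ} (W? : Decidable W) (half : IsHalfSystem γ W)
    {E : Pred Point 0ℓ} (E? : Decidable E)
    {F : Pred Params 0ℓ} (F? : Decidable F) (F⊆W : ∀ v t → F (v , t) → W v) where

    open IsHalfSystem half using (normed)

    pairList : List (Point × Params)
    pairList = cartesianProduct (filter E? points) (filter F? params)

    classes : List (Point × Params)
    classes = deduplicate _∼?_ pairList

    _≈±_ : Point × Params → Point × Params → Set
    p ≈± p′ = offset p ≡ offset p′ ⊎ offset p ≡ - offset p′

    ≈±-trans : ∀ {p p′ p″} → p ≈± p′ → p′ ≈± p″ → p ≈± p″
    ≈±-trans (inj₁ e) (inj₁ e′) = inj₁ (trans e e′)
    ≈±-trans (inj₁ e) (inj₂ e′) = inj₂ (trans e e′)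
    ≈±-trans (inj₂ e) (inj₁ e′) = inj₂ (trans e (cong -_ e′))
    ≈±-trans (inj₂ e) (inj₂ e′) = inj₁ (trans e (trans (cong -_ e′) (FieldProperties.-‿involutive 𝔽 _)))

    offsets : List Carrier
    offsets = pairs -_ (map offset classes)

    length-offsets : length offsets ≡ 2 ℕ.* length classes
    length-offsets = trans (length-pairs -_ (map offset classes))
      (cong (2 ℕ.*_) (length-map offset classes))

    -- Deduplication is tracked through `_≈±_`. The side condition P on norms, which `∼⇒offset±`
    -- needs, holds on the whole list because F lies over W.
    offsets-cover : ∀ {x v t} → E x → F (v , t) → offset (x , v , t) ∈ offsets
    offsets-cover {x} {v} {t} Ex Fvt = member (deduplicate-covers
        {T = _≈±_} _∼?_ {P = λ (_ , v , _) → NormOneOr γ v} (inj₁ refl)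
        (λ {p} {p′} {p″} → ≈±-trans {p} {p′} {p″})
        (λ {p} {p′} → ∼⇒offset± γ≢0 ¬□γ (half⇒1≢-1 𝔽 half) p p′)
        pairList (λ {p} → normed-pair {p})
        (∈-cartesianProduct⁺ (∈-filter⁺ E? (∈-points₀ x) Ex)
          (∈-filter⁺ F? (∈-cartesianProduct⁺ (∈-points₀ v) (FiniteField.∈-elements 𝔽 t)) Fvt)))
      where
      normed-pair : ∀ {p} → p ∈ pairList → NormOneOr γ (proj₁ (proj₂ p))
      normed-pair {x , v , t} p∈ = normed v (F⊆W v t (proj₂ (∈-filter⁻ F? {xs = params}
        (proj₂ (∈-cartesianProduct⁻ (filter E? points) (filter F? params) p∈)))))
      member : (∃ λ r → r ∈ classes × r ≈± (x , v , t)) → offset (x , v , t) ∈ offsets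
      member (r , r∈ , inj₁ eq) = subst (_∈ offsets) eq (∈-pairs₁ -_ (∈-map⁺ offset r∈))
      member (r , r∈ , inj₂ eq) = subst (_∈ offsets)
        (trans (cong -_ eq) (FieldProperties.-‿involutive 𝔽 _)) (∈-pairs₂ -_ (∈-map⁺ offset r∈))

    dual : ∀ {v} → W v → ∃ λ w → w · v ≡ 1#
    dual {v} Wv = ‖v‖≢0⇒dual v (norm≢0 γ≢0 ¬□γ v (normed v Wv))

    separated : ∀ {v v′} → W v → W v′ → v ≢ v′ → ∃ λ w → w · v ≡ 1# × w · v′ ≡ 0#
    separated {v} {v′} Wv Wv′ v≢v′ = separate γ≢0 ¬□γ v v′ (normed v Wv) (normed v′ Wv′)
      v≢v′ (half-no-opposite half Wv Wv′)

    fibre : Point → ℕ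
    fibre v = sum (map (indicator F? v) elements)

    fibre≡∑ : ∀ v → + fibre v ≡ ∑ elements (λ t → 𝟙 (F? (v , t)))
    fibre≡∑ v = go elements
      where
      go : ∀ ts → + sum (map (indicator F? v) ts) ≡ ∑ ts (λ t → 𝟙 (F? (v , t)))
      go []       = refl
      go (t ∷ ts) with does (F? (v , t))
      ... | true  = cong (λ n → + 1 ℤ.+ n) (go ts)
      ... | false = cong (λ n → + 0 ℤ.+ n) (go ts)

    fibre≤q : ∀ v → fibre v ≤ q
    fibre≤q v = ℤ.drop‿+≤+ (subst₂ ℤ._≤_ (sym (fibre≡∑ v))
      (trans (∑-1 elements) (cong +_ length-elements))
      (∑-mono elements (λ t → 𝟙≤1 (F? (v , t)))))

    maxFibre≤q : maxFibre W? F? ≤ q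
    maxFibre≤q = max≤v⁺ z≤n (All.map⁺ (All.universal fibre≤q (filter W? points)))

    -- The indicator of W on the right confines the later sum of energies to the directions covered
    -- by Bessel's inequality.
    fibre≤ : ∀ v → ∑ elements (λ t → 𝟙 (F? (v , t))) ℤ.≤ 𝟙 (W? v) ℤ.* + maxFibre W? F?
    fibre≤ v with W? v
    ... | yes Wv = subst₂ ℤ._≤_ (fibre≡∑ v) (sym (ℤ.*-identityˡ _))
      (ℤ.+≤+ (All.lookup (xs≤max 0 (map fibre (filter W? points))) (∈-map⁺ fibre (∈-filter⁺ W? (∈-points₀ v) Wv))))
    ... | no ¬Wv = ℤ.≤-reflexive (trans
      (∑-cong elements (λ t → 𝟙-no (F? (v , t)) (¬Wv ∘ F⊆W v t))) (∑-0 elements))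

    -- The division-free form, multiplied through by q, from which both claims of the theorem
    -- follow.
    incidence-bound :
      let m = cardₕ F? ℕ.* card E? in
      q ℕ.* (m ℕ.* m) ≤ 2 ℕ.* cardΔ E? F? ℕ.*
        (m ℕ.* m ℕ.+ cardₕ F? ℕ.* maxFibre W? F? ℕ.* card E? ℕ.* q ℕ.^ d)
    incidence-bound = ℤ.drop‿+≤+ (begin
      + (q ℕ.* (m ℕ.* m))                ≡⟨ trans (ℤ.pos-* q _) (cong (+ q ℤ.*_) mm≡) ⟩
      + q ℤ.* (μ ℤ.* μ)                  ≤⟨ *-monoˡ-≤ {+ q} (ℤ.+≤+ z≤n) (∣F∣∣E∣²≤ offsets offsets-cover) ⟩
      + q ℤ.* (ℓ ℤ.* ∑-count²)           ≡⟨ swap (+ q) ℓ ∑-count² ⟩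
      ℓ ℤ.* (+ q ℤ.* ∑-count²)           ≤⟨ *-monoˡ-≤ {ℓ} (ℤ.+≤+ z≤n) (∑-count²≤ fibre≤ (ℤ.+≤+ z≤n)) ⟩
      ℓ ℤ.* (μ ℤ.* μ ℤ.+ ∣F∣ ℤ.* + M ℤ.* ∣E∣ E? ℤ.* + length points)
        ≡⟨ cong₂ ℤ._*_ (cong +_ (sym length-offsets)) (cong₂ ℤ._+_ mm≡ rest≡) ⟨
      + (2 ℕ.* k) ℤ.* (+ (m ℕ.* m) ℤ.+ + (cardₕ F? ℕ.* M ℕ.* card E? ℕ.* q ℕ.^ d))
        ≡⟨ ℤ.pos-* (2 ℕ.* k) _ ⟨
      + (2 ℕ.* k ℕ.* (m ℕ.* m ℕ.+ cardₕ F? ℕ.* M ℕ.* card E? ℕ.* q ℕ.^ d)) ∎)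
      where
      open ℤ.≤-Reasoning
      open Bessel E? W? dual separated
      open Offsets F?
      open import Data.Integer.Tactic.RingSolver using (solve-∀)
      k = cardΔ E? F?
      M = maxFibre W? F?
      m = cardₕ F? ℕ.* card E?
      μ = ∣F∣ ℤ.* ∣E∣ E?
      ℓ = + length offsets
      swap : ∀ a b c → a ℤ.* (b ℤ.* c) ≡ b ℤ.* (a ℤ.* c)
      swap = solve-∀
      m≡ : + m ≡ μ
      m≡ = trans (ℤ.pos-* (cardₕ F?) (card E?))
        (cong₂ ℤ._*_ (length-filter F? params) (length-filter E? points))
      mm≡ : + (m ℕ.* m) ≡ μ ℤ.* μ
      mm≡ = trans (ℤ.pos-* m m) (cong₂ ℤ._*_ m≡ m≡)
      rest≡ : + (cardₕ F? ℕ.* M ℕ.* card E? ℕ.* q ℕ.^ d) ≡ ∣F∣ ℤ.* + M ℤ.* ∣E∣ E? ℤ.* + length points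
      rest≡ = trans (ℤ.pos-* (cardₕ F? ℕ.* M ℕ.* card E?) (q ℕ.^ d)) (cong₂ ℤ._*_
        (trans (ℤ.pos-* (cardₕ F? ℕ.* M) (card E?)) (cong₂ ℤ._*_
          (trans (ℤ.pos-* (cardₕ F?) M) (cong (ℤ._* + M) (length-filter F? params)))
          (length-filter E? points)))
        (cong +_ (sym (length-points d))))

-- The rational lower bound and the threshold q^(d+1).

open import Data.Integer using (+_)
open import Data.Nat using (_∸_; _^_; _≤_; _<_) renaming (_*_ to _ℕ*_; _+_ to _ℕ+_)

mainTheorem2 :
    (q : ℕ) → IsOddPrimePower q →
    (𝔽 : FiniteField q) →
    (d : ℕ) → 2 ≤ d →
    let open FiniteField 𝔽
        open Geometry 𝔽 d
    in
    (γ : Carrier) → γ ≢ 0# → ¬ IsSquare γ →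
    (W : Pred Point 0ℓ) (W? : Decidable W) → IsHalfSystem γ W →
    (E : Pred Point 0ℓ) (E? : Decidable E) →
    (F : Pred (Point × Carrier) 0ℓ) (F? : Decidable F) →
    (∀ v t → F (v , t) → W v) →
    let ∣E∣ = card E?
        ∣F∣ = cardₕ F?
        ∣Δ∣ = cardΔ E? F?
        numerator   = fromℕ (∣E∣ ^ 2 ℕ* ∣F∣ ^ 2)
        q⁻¹         = ℚ._/_ (+ 1) q {{q-nonZero}}
        denominator = (fromℕ 2 ℚ.* q⁻¹ ℚ.* fromℕ (∣E∣ ^ 2 ℕ* ∣F∣ ^ 2))
                      ℚ.+ fromℕ (2 ℕ* q ^ (d ∸ 1) ℕ* ∣E∣ ℕ* ∣F∣ ℕ* maxFibre W? F?)
    in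
    (.{{_ : ℚ.NonZero denominator}} → numerator ℚ.÷ denominator ℚ.≤ fromℕ ∣Δ∣)
    × (q ^ (d ℕ+ 1) < ∣E∣ ℕ* ∣F∣ → (+ q) ℚ./ 4 ℚ.< fromℕ ∣Δ∣)
mainTheorem2 q _ 𝔽 d@(suc d′) 2≤d γ γ≢0 ¬□γ W W? half E E? F F? F⊆W =
  ÷-≤ q {{q-nonZero}} k (e ^ 2 ℕ* f ^ 2) (2 ℕ* q ^ d′ ℕ* e ℕ* f ℕ* M)
    (subst₂ _≤_ (lhs q e f) (rhs k e f M q (q ^ d′)) bound)
  , λ large → /-< {m = q} {k = k} 4 (<-of-dominated {q} {k} 0<q (dominated large) bound)
  where
  open FiniteField 𝔽 using (q-nonZero)
  open Geometry 𝔽 d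
  open Incidence 𝔽 d′
  open FromℕProperties
  open import Data.Nat.Tactic.RingSolver using (solve-∀)
  e = card E?
  f = cardₕ F?
  k = cardΔ E? F?
  M = maxFibre W? F?
  bound : q ℕ* (f ℕ* e ℕ* (f ℕ* e)) ≤ 2 ℕ* k ℕ* (f ℕ* e ℕ* (f ℕ* e) ℕ+ f ℕ* M ℕ* e ℕ* q ^ d)
  bound = incidence-bound γ≢0 ¬□γ W? half E? F? F⊆W
  0<q : 0 < q
  0<q = ℕ.>-nonZero⁻¹ q {{q-nonZero}}
  -- In `lhs` and `rhs` the powers appear as they reduce: `e ^ 2` is e (e 1), and `q ^ d` is q times
  -- p with p = `q ^ d′`.
  lhs : ∀ q e f → q ℕ* (f ℕ* e ℕ* (f ℕ* e)) ≡ q ℕ* ((e ℕ* (e ℕ* 1)) ℕ* (f ℕ* (f ℕ* 1)))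
  lhs = solve-∀
  rhs : ∀ k e f M q p →
    2 ℕ* k ℕ* (f ℕ* e ℕ* (f ℕ* e) ℕ+ f ℕ* M ℕ* e ℕ* (q ℕ* p))
    ≡ k ℕ* (2 ℕ* ((e ℕ* (e ℕ* 1)) ℕ* (f ℕ* (f ℕ* 1))) ℕ+ q ℕ* (2 ℕ* p ℕ* e ℕ* f ℕ* M))
  rhs = solve-∀
  -- A fibre has at most q elements, so M ≤ q and the error term is at most f e q^(d+1), which the
  -- threshold puts below (f e)².
  dominated : q ^ (d ℕ+ 1) < e ℕ* f → f ℕ* M ℕ* e ℕ* q ^ d < f ℕ* e ℕ* (f ℕ* e)
  dominated large = begin-strict
    f ℕ* M ℕ* e ℕ* q ^ d         ≡⟨ regroup f M e (q ^ d) ⟩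
    f ℕ* e ℕ* (q ^ d ℕ* M)       ≤⟨ ℕ.*-monoʳ-≤ (f ℕ* e)
      (ℕ.*-monoʳ-≤ (q ^ d) (maxFibre≤q γ≢0 ¬□γ W? half E? F? F⊆W)) ⟩
    f ℕ* e ℕ* (q ^ d ℕ* q)       ≡⟨ cong (λ r → f ℕ* e ℕ* r) (trans (ℕ.*-comm (q ^ d) q) (cong (q ^_) (ℕ.+-comm 1 d))) ⟩
    f ℕ* e ℕ* q ^ (d ℕ+ 1)       <⟨ ℕ.*-monoʳ-< (f ℕ* e) {{ℕ.>-nonZero (ℕ.≤-<-trans z≤n large′)}} large′ ⟩
    f ℕ* e ℕ* (f ℕ* e)           ∎
    where
    open ℕ.≤-Reasoning
    large′ : q ^ (d ℕ+ 1) < f ℕ* e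
    large′ = subst (q ^ (d ℕ+ 1) <_) (ℕ.*-comm e f) large
    regroup : ∀ f M e p → f ℕ* M ℕ* e ℕ* p ≡ f ℕ* e ℕ* (p ℕ* M)
    regroup = solve-∀
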